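{- The tableau calculus $\mathcal T_{\mathcal{SO}}$ is sound and constructively complete for the description logic $\mathcal{SO}$. Furthermore, $\mathcal T_{\mathcal{SO}}$ is terminating provided that conditions (c1) and (c2) (stated in the context) are both true for $\mathcal T_{\mathcal{SO}}$-derivations.
   Context: **The logic $\mathcal{SO}$.** There are countably many individual variables $\ell_0,\ell_1,\dots$, concept symbols $p_0,p_1,\dots$ and role symbols $r_0,r_1,\dots$. Concepts: $C::=p\mid\{\ell\}\mid\neg C\mid C\vee D\mid\exists r.C$. An $\mathcal{SO}$-model $\mathcal I$ has a non-empty domain $\Delta^{\mathcal I}$, assigns to each individual an element of $\Delta^{\mathcal I}$, to each concept symbol a subset of $\Delta^{\mathcal I}$, to each role symbol a transitive binary relation on $\Delta^{\mathcal I}$, and interprets $\{\ell\}$ as the singleton of the element assigned to $\ell$, $\neg,\vee$ as complement and union, and $\exists r.C$ as $\{x\mid\exists y\,((x,y)\in r^{\mathcal I}\wedge y\in C^{\mathcal I})\}$. A set $\mathcal S$ of concepts is satisfiable if some element of some model lies in $C^{\mathcal I}$ for all $C\in\mathcal S$. For the tableau calculus the language is extended by a connective $\ell:C$ (true at every point iff the element denoted by $\ell$ is in $C^{\mathcal I}$) and by individual terms $f(r,C,\ell)$ ($r$ a role symbol, $C$ a concept, $\ell$ an individual term), which are again individuals and may occur in $\{\cdot\}$. **Tableaux.** Rules have the form $X_0/X_1\mid\cdots\mid X_n$ ($\bot$ if $n=0$, a closure rule). For an input set $\mathcal S$ of concepts the root of a tableau is $\{a:C\mid C\in\mathcal S\}$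 with $a$ a fresh individual. Applying a rule to a node containing instances of all its premises creates $n$ successors, the $i$-th adding the instance of $X_i$; each rule is applied at most once to the same premises. $T(\mathcal S)$ is a finished tableau (all applicable rules have been applied on all branches, in the limit). A branch is a maximal path, identified with the union of its nodes; it is closed if a closure rule has been applied on it and open otherwise; a tableau is closed if all its branches are closed, otherwise open. **Rules of $\mathcal T_{\mathcal{SO}}$** ($\ell,\ell',\ell''$ range over individual terms, $p,q$ over concepts, $r$ over role symbols): $\ell:\neg\neg p\,/\,\ell:p$; $\ell:(p\vee q)\,/\,\ell:p\mid\ell:q$; $\ell:\neg(p\vee q)\,/\,\ell:\neg p,\ \ell:\neg q$; $\ell:\exists r.p\,/\,\ell:\exists r.\{f(r,p,\ell)\},\ f(r,p,\ell):p$; $\ell:\neg\exists r.p,\ \ell:\exists r.\{\ell'\}\,/\,\ell':\neg p$; $\ell:\exists r.\{\ell'\},\ \ell':\exists r.\{\ell''\}\,/\,\ell:\exists r.\{\ell''\}$; $\ell:\{\ell'\}\,/\,\ell':\{\ell\}$; $\ell:\neg\{\ell'\}\,/\,\ell':\{\ell'\}$; $\ell:p\,/\,\ell:\{\ell\}$; $\ell:\neg\exists r.\{\ell'\}\,/\,\ell':\{\ell'\}$; $\ell:p,\ \ell:\{\ell'\}\,/\,\ell':p$; $\ell:\exists r.\{\ell'\},\ \ell':\{\ell''\}\,/\,\ell:\exists r.\{\ell''\}$; $f(r,p,\ell):\{f(r,p,\ell)\},\ \ell:\{\ell'\}\,/\,f(r,p,\ell):\{f(r,p,\ell')\}$; closure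 rule $\ell:p,\ \ell:\neg p\,/\,\bot$; unrestricted blocking rule (ub$'$): $\ell:\{\ell\},\ \ell':\{\ell'\}\,/\,\ell:\{\ell'\}\mid\ell:\neg\{\ell'\}$. **Properties.** Sound: for every (possibly infinite) satisfiable set $\mathcal S$ of concepts, every $T(\mathcal S)$ is open. Constructively complete: for every set $\mathcal S$ of concepts and every open branch $\mathcal B$ of a $T(\mathcal S)$ there is an $\mathcal{SO}$-model $\mathcal I$ (interpreting individual terms as well) whose domain is the set of equivalence classes $\|t\|$ of individual terms $t$ occurring in $\mathcal B$ under $t\sim t'$ iff $t:\{t'\}\in\mathcal B$, with each such $t$ denoting $\|t\|$, and such that $\|t\|\in C^{\mathcal I}$ whenever $t:C\in\mathcal B$. Terminating: for every finite set $\mathcal S$ of concepts, every closed tableau $T(\mathcal S)$ is finite and every open tableau $T(\mathcal S)$ has a finite open branch. **Conditions.** Let $<$ be an ordering of the individual terms in a branch that is a linear extension of the order of their introduction in the derivation ($t<t'$ whenever the first appearance of $t'$ is strictly later than that of $t$). The only rule producing new terms is $\ell:\exists r.p\,/\,\ell:\exists r.\{f(r,p,\ell)\},\,f(r,p,\ell):p$. (c1) If $t:\{t'\}$ appears in a branch and $t<t'$, then possible applications of term-producing rules to formulae with the term $t'$ are not performed. (c2) In every open branch there is some node from which point onwards, before any application of a term-producing rule, all possible applications of (ub$'$) have been performed.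
   Formalization: Completeness: nonempty S, and terms t with some t:C in B (else ∼ is not reflexive). In (c1), (c2) the f-rule counts as term-producing when f(r,p,ℓ′) is new; (c1) reads t′ as label or as the term in {t′}, ∃r.{t′}; (c2) requires (ub′) for all labels. Literal versions fail. -}

module Defs where

open import Level using (0ℓ)
open import Data.Nat using (ℕ; suc; _≤_)
open import Data.Fin using (Fin)
open import Data.List using (List; []; _∷_; map; length; lookup)
open import Data.List.Membership.Propositional using () renaming (_∈_ to _∈ˡ_; _∉_ to _∉ˡ_)
open import Data.List.Relation.Unary.All using (All)
open import Data.List.Relation.Unary.Any using (Any)
open import Data.Maybe using (Maybe; just)
open import Data.Product using (Σ; Σ-syntax; ∃; ∃-syntax; _×_; _,_; proj₁)
open import Data.Sum using (_⊎_)
open import Function.Bundles using (_⇔_)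
open import Relation.Binary.Core using (Rel)
open import Relation.Binary.Definitions using (Transitive)
open import Relation.Binary.Structures using (IsStrictTotalOrder)
open import Relation.Binary.PropositionalEquality using (_≡_)
open import Relation.Nullary using (¬_)
open import Relation.Unary using (Pred; _∈_; _⊆_)

infix  9 ¬ᶜ_
infixr 8 _∨ᶜ_
infix  7 _∶_

------------------------------------------------------------------------
-- The logic SO.  Individuals, concept symbols and role symbols are all
-- indexed by ℕ.

data Concept : Set where
  atom : ℕ → Concept
  nom  : ℕ → Concept
  ¬ᶜ_  : Concept → Concept
  _∨ᶜ_ : Concept → Concept → Concept
  ∃ᶜ   : ℕ → Concept → Concept

-- The domain is non-empty because it contains ind 0.
record Model : Set₁ where
  field
    Δ          : Set
    ind        : ℕ → Δ
    conc       : ℕ → Pred Δ 0ℓ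
    role       : ℕ → Rel Δ 0ℓ
    role-trans : ∀ r → Transitive (role r)

module _ (I : Model) where
  open Model I

  ⟦_⟧ : Concept → Pred Δ 0ℓ
  ⟦ atom p ⟧ x = conc p x
  ⟦ nom n ⟧  x = x ≡ ind n
  ⟦ ¬ᶜ C ⟧   x = ¬ ⟦ C ⟧ x
  ⟦ C ∨ᶜ D ⟧ x = ⟦ C ⟧ x ⊎ ⟦ D ⟧ x
  ⟦ ∃ᶜ r C ⟧ x = ∃[ y ] (role r x y × ⟦ C ⟧ y)

ConceptSet : Set₁
ConceptSet = Pred Concept 0ℓ

Satisfiable : ConceptSet → Set₁
Satisfiable S = Σ[ I ∈ Model ] ∃[ x ] (∀ C → C ∈ S → x ∈ ⟦_⟧ I C)

Finite : ConceptSet → Set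
Finite S = ∃[ Cs ] (S ⊆ (_∈ˡ Cs))

------------------------------------------------------------------------
-- The language of the tableau calculus.  The constant fresh is the
-- individual labelling the root of a tableau: a possibly infinite input
-- set may use every individual variable, so it has to be a new symbol.

data Term : Set
data XConcept : Set

data Term where
  ind   : ℕ → Term
  fresh : Term
  f     : ℕ → XConcept → Term → Term

data XConcept where
  atom : ℕ → XConcept
  nom  : Term → XConcept
  ¬ᶜ_  : XConcept → XConcept
  _∨ᶜ_ : XConcept → XConcept → XConcept
  ∃ᶜ   : ℕ → XConcept → XConcept
  _∶_  : Term → XConcept → XConcept

embed : Concept → XConcept
embed (atom p) = atom p
embed (nom n)  = nom (ind n)
embed (¬ᶜ C)   = ¬ᶜ embed C
embed (C ∨ᶜ D) = embed C ∨ᶜ embed D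
embed (∃ᶜ r C) = ∃ᶜ r (embed C)

record TermModel : Set₁ where
  field
    model   : Model
  open Model model public renaming (ind to indᴵ)
  field
    den     : Term → Δ
    den-ind : ∀ n → den (ind n) ≡ indᴵ n

module _ (J : TermModel) where
  open TermModel J

  ⟦_⟧ˣ : XConcept → Pred Δ 0ℓ
  ⟦ atom p ⟧ˣ x = conc p x
  ⟦ nom t ⟧ˣ  x = x ≡ den t
  ⟦ ¬ᶜ C ⟧ˣ   x = ¬ ⟦ C ⟧ˣ x
  ⟦ C ∨ᶜ D ⟧ˣ x = ⟦ C ⟧ˣ x ⊎ ⟦ D ⟧ˣ x
  ⟦ ∃ᶜ r C ⟧ˣ x = ∃[ y ] (role r x y × ⟦ C ⟧ˣ y)
  ⟦ t ∶ C ⟧ˣ  x = ⟦ C ⟧ˣ (den t)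

-- Occurrence anywhere, including inside the arguments of f.
data _occursInᵗ_ (t : Term) : Term → Set
data _occursIn_ (t : Term) : XConcept → Set

data _occursInᵗ_ t where
  here  : t occursInᵗ t
  f-con : ∀ {r C u} → t occursIn C → t occursInᵗ f r C u
  f-arg : ∀ {r C u} → t occursInᵗ u → t occursInᵗ f r C u

data _occursIn_ t where
  nom   : ∀ {u} → t occursInᵗ u → t occursIn nom u
  neg   : ∀ {C} → t occursIn C → t occursIn (¬ᶜ C)
  left  : ∀ {C D} → t occursIn C → t occursIn (C ∨ᶜ D)
  right : ∀ {C D} → t occursIn D → t occursIn (C ∨ᶜ D)
  some  : ∀ {r C} → t occursIn C → t occursIn ∃ᶜ r C
  label : ∀ {u C} → t occursInᵗ u → t occursIn (u ∶ C)
  body  : ∀ {u C} → t occursIn C → t occursIn (u ∶ C)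

Formulas : Set₁
Formulas = Pred XConcept 0ℓ

Occurs : Formulas → Term → Set
Occurs Γ t = ∃[ φ ] (φ ∈ Γ × t occursIn φ)

IsLabel : Formulas → Term → Set
IsLabel Γ t = ∃[ C ] (t ∶ C) ∈ Γ

------------------------------------------------------------------------
-- The rules.  An element of Rule is a rule instance; it is determined by
-- the name of the rule and the list of its premises.

data Rule : Set where
  not-not  : (ℓ : Term) (p : XConcept) → Rule
  or       : (ℓ : Term) (p q : XConcept) → Rule
  not-or   : (ℓ : Term) (p q : XConcept) → Rule
  ex       : (ℓ : Term) (r : ℕ) (p : XConcept) → Rule
  not-ex   : (ℓ ℓ′ : Term) (r : ℕ) (p : XConcept) → Rule
  trans    : (ℓ ℓ′ ℓ″ : Term) (r : ℕ) → Rule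
  sym      : (ℓ ℓ′ : Term) → Rule
  not-nom  : (ℓ ℓ′ : Term) → Rule
  refl     : (ℓ : Term) (p : XConcept) → Rule
  not-edge : (ℓ ℓ′ : Term) (r : ℕ) → Rule
  subst    : (ℓ ℓ′ : Term) (p : XConcept) → Rule
  edge     : (ℓ ℓ′ ℓ″ : Term) (r : ℕ) → Rule
  f-cong   : (ℓ ℓ′ : Term) (r : ℕ) (p : XConcept) → Rule
  closure  : (ℓ : Term) (p : XConcept) → Rule
  ub′      : (ℓ ℓ′ : Term) → Rule

premises : Rule → List XConcept
premises (not-not ℓ p)      = ℓ ∶ ¬ᶜ (¬ᶜ p) ∷ []
premises (or ℓ p q)         = ℓ ∶ (p ∨ᶜ q) ∷ []
premises (not-or ℓ p q)     = ℓ ∶ ¬ᶜ (p ∨ᶜ q) ∷ []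
premises (ex ℓ r p)         = ℓ ∶ ∃ᶜ r p ∷ []
premises (not-ex ℓ ℓ′ r p)  = ℓ ∶ ¬ᶜ (∃ᶜ r p) ∷ ℓ ∶ ∃ᶜ r (nom ℓ′) ∷ []
premises (trans ℓ ℓ′ ℓ″ r)  = ℓ ∶ ∃ᶜ r (nom ℓ′) ∷ ℓ′ ∶ ∃ᶜ r (nom ℓ″) ∷ []
premises (sym ℓ ℓ′)         = ℓ ∶ nom ℓ′ ∷ []
premises (not-nom ℓ ℓ′)     = ℓ ∶ ¬ᶜ (nom ℓ′) ∷ []
premises (refl ℓ p)         = ℓ ∶ p ∷ []
premises (not-edge ℓ ℓ′ r)  = ℓ ∶ ¬ᶜ (∃ᶜ r (nom ℓ′)) ∷ []
premises (subst ℓ ℓ′ p)     = ℓ ∶ p ∷ ℓ ∶ nom ℓ′ ∷ []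
premises (edge ℓ ℓ′ ℓ″ r)   = ℓ ∶ ∃ᶜ r (nom ℓ′) ∷ ℓ′ ∶ nom ℓ″ ∷ []
premises (f-cong ℓ ℓ′ r p)  = f r p ℓ ∶ nom (f r p ℓ) ∷ ℓ ∶ nom ℓ′ ∷ []
premises (closure ℓ p)      = ℓ ∶ p ∷ ℓ ∶ ¬ᶜ p ∷ []
premises (ub′ ℓ ℓ′)         = ℓ ∶ nom ℓ ∷ ℓ′ ∶ nom ℓ′ ∷ []

conclusions : Rule → List (List XConcept)
conclusions (not-not ℓ p)      = (ℓ ∶ p ∷ []) ∷ []
conclusions (or ℓ p q)         = (ℓ ∶ p ∷ []) ∷ (ℓ ∶ q ∷ []) ∷ []
conclusions (not-or ℓ p q)     = (ℓ ∶ ¬ᶜ p ∷ ℓ ∶ ¬ᶜ q ∷ []) ∷ []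
conclusions (ex ℓ r p)         = (ℓ ∶ ∃ᶜ r (nom (f r p ℓ)) ∷ f r p ℓ ∶ p ∷ []) ∷ []
conclusions (not-ex ℓ ℓ′ r p)  = (ℓ′ ∶ ¬ᶜ p ∷ []) ∷ []
conclusions (trans ℓ ℓ′ ℓ″ r)  = (ℓ ∶ ∃ᶜ r (nom ℓ″) ∷ []) ∷ []
conclusions (sym ℓ ℓ′)         = (ℓ′ ∶ nom ℓ ∷ []) ∷ []
conclusions (not-nom ℓ ℓ′)     = (ℓ′ ∶ nom ℓ′ ∷ []) ∷ []
conclusions (refl ℓ p)         = (ℓ ∶ nom ℓ ∷ []) ∷ []
conclusions (not-edge ℓ ℓ′ r)  = (ℓ′ ∶ nom ℓ′ ∷ []) ∷ []
conclusions (subst ℓ ℓ′ p)     = (ℓ′ ∶ p ∷ []) ∷ []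
conclusions (edge ℓ ℓ′ ℓ″ r)   = (ℓ ∶ ∃ᶜ r (nom ℓ″) ∷ []) ∷ []
conclusions (f-cong ℓ ℓ′ r p)  = (f r p ℓ ∶ nom (f r p ℓ′) ∷ []) ∷ []
conclusions (closure ℓ p)      = []
conclusions (ub′ ℓ ℓ′)         = (ℓ ∶ nom ℓ′ ∷ []) ∷ (ℓ ∶ ¬ᶜ (nom ℓ′) ∷ []) ∷ []

------------------------------------------------------------------------
-- Tableaux.  A node is given by its history: the rule instances applied
-- on the way from the root, latest first, each with the conclusion chosen.

Choice : Rule → Set
Choice ρ = Fin (length (conclusions ρ))

History : Set
History = List (Σ Rule Choice)

applied : History → List Rule
applied = map proj₁

formulas : ConceptSet → History → Formulas
formulas S []            φ = ∃[ C ] (C ∈ S × φ ≡ fresh ∶ embed C)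
formulas S ((ρ , i) ∷ h) φ = φ ∈ formulas S h ⊎ φ ∈ˡ lookup (conclusions ρ) i

Applicable : Formulas → Rule → Set
Applicable Γ ρ = All (_∈ Γ) (premises ρ)

data Node (rule-at : History → Maybe Rule) : History → Set where
  root  : Node rule-at []
  child : ∀ {h ρ} → Node rule-at h → rule-at h ≡ just ρ → (i : Choice ρ) →
          Node rule-at ((ρ , i) ∷ h)

-- rule-at h is the rule instance applied at the node h, if any; its values
-- at histories that are not nodes play no role.
record Tableau (S : ConceptSet) : Set where
  field
    rule-at    : History → Maybe Rule
    applicable : ∀ {h ρ} → Node rule-at h → rule-at h ≡ just ρ →
                 Applicable (formulas S h) ρ
    once       : ∀ {h ρ} → Node rule-at h → rule-at h ≡ just ρ → ρ ∉ˡ applied h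

module _ {S : ConceptSet} (T : Tableau S) where
  open Tableau T

  -- Also true where a closure rule is applied, which creates no successors.
  Leaf : History → Set
  Leaf h = ∀ ρ → rule-at h ≡ just ρ → conclusions ρ ≡ []

  data Step (h : History) : History → Set where
    extend : ∀ {ρ} → rule-at h ≡ just ρ → (i : Choice ρ) → Step h ((ρ , i) ∷ h)
    halt   : Leaf h → Step h h

  -- A maximal path, as an infinite sequence of nodes that becomes constant
  -- if and when a leaf is reached.
  record Branch : Set where
    field
      at    : ℕ → History
      start : at 0 ≡ []
      step  : ∀ n → Step (at n) (at (suc n))

  open Branch

  ⋃ : Branch → Formulas
  ⋃ β φ = ∃[ n ] φ ∈ formulas S (at β n)

  AppliedOn : Branch → Rule → Set
  AppliedOn β ρ = ∃[ n ] rule-at (at β n) ≡ just ρ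

  ClosedBranch : Branch → Set
  ClosedBranch β = ∃[ ρ ] (conclusions ρ ≡ [] × AppliedOn β ρ)

  OpenBranch : Branch → Set
  OpenBranch β = ¬ ClosedBranch β

  FiniteBranch : Branch → Set
  FiniteBranch β = ∃[ n ] Leaf (at β n)

  Closed : Set
  Closed = ∀ β → ClosedBranch β

  Open : Set
  Open = ¬ Closed

  FiniteTableau : Set
  FiniteTableau = ∃[ hs ] (∀ h → Node rule-at h → h ∈ˡ hs)

  -- All rule instances that become applicable on an open branch have been
  -- applied on it, except those that are exempt.
  FinishedExcept : (Branch → Rule → Set) → Set
  FinishedExcept Exempt =
    ∀ β → OpenBranch β → ∀ ρ → Applicable (⋃ β) ρ → ¬ Exempt β ρ → AppliedOn β ρ

  Finished : Set
  Finished = ∀ β → OpenBranch β → ∀ ρ → Applicable (⋃ β) ρ → AppliedOn β ρ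

------------------------------------------------------------------------
-- Soundness and constructive completeness.

Sound : Set₁
Sound = ∀ S → Satisfiable S → (T : Tableau S) → Finished T → Open T

-- On labels, den is the quotient map onto the classes of t ∼ t′ iff
-- t ∶ nom t′ ∈ B: it is onto Δ and its kernel is ∼.  So Δ is the set of
-- these classes and each label t denotes its class.
record CanonicalModel (B : Formulas) : Set₁ where
  field
    termModel : TermModel
  open TermModel termModel public
  field
    onto   : ∀ d → ∃[ t ] (IsLabel B t × den t ≡ d)
    kernel : ∀ t t′ → IsLabel B t → IsLabel B t′ → den t ≡ den t′ ⇔ (t ∶ nom t′) ∈ B
    truth  : ∀ t C → (t ∶ C) ∈ B → den t ∈ ⟦ termModel ⟧ˣ C

-- For the empty input no term occurs in the branch, and the set of classes
-- would not be a non-empty domain; hence the hypothesis ∃ S.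
ConstructivelyComplete : Set₁
ConstructivelyComplete =
  ∀ S → ∃ S → (T : Tableau S) → Finished T →
  ∀ β → OpenBranch T β → CanonicalModel (⋃ T β)

------------------------------------------------------------------------
-- Termination under conditions (c1) and (c2).

Terminating : (∀ {S} → Tableau S → Set₁) → Set₁
Terminating Derivation =
  ∀ S → Finite S → (T : Tableau S) → Derivation T →
  (Closed T → FiniteTableau T) ×
  (Open T → ∃[ β ] (OpenBranch T β × FiniteBranch T β))

-- ex is the rule that produces new terms.  An instance of f-cong counts as
-- well if its conclusion would bring f r p ℓ′ into Γ for the first time:
-- otherwise fresh ∶ nom (f r p fresh) would start the infinite sequence of
-- terms f r p fresh, f r p (f r p fresh), ...
data TermProducing (Γ : Formulas) : Rule → Set where
  ex     : ∀ {ℓ r p} → TermProducing Γ (ex ℓ r p)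
  f-cong : ∀ {ℓ ℓ′ r p} → ¬ Occurs Γ (f r p ℓ′) → TermProducing Γ (f-cong ℓ ℓ′ r p)

-- φ is a formula with the term t when it makes an assertion about t, where
-- t ∶ nom u stands for t ≈ u and t ∶ ∃ᶜ r (nom u) for r(t , u).  A nominal
-- inside another concept C in t ∶ ∃ᶜ r C does not count: with u ∶ nom v it
-- would block the expansion of t ∶ ∃ᶜ r C for a t that is not itself blocked.
data _with-term_ : XConcept → Term → Set where
  label  : ∀ {t C}   → (t ∶ C) with-term t
  equal  : ∀ {t u}   → (t ∶ nom u) with-term u
  linked : ∀ {t r u} → (t ∶ ∃ᶜ r (nom u)) with-term u

Blocked : Rel Term 0ℓ → Formulas → Rule → Set
Blocked _<_ Γ ρ =
  TermProducing Γ ρ ×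
  ∃[ t ] ∃[ t′ ] ((t ∶ nom t′) ∈ Γ × t < t′ × Any (_with-term t′) (premises ρ))

module _ {S : ConceptSet} (T : Tableau S) where
  open Tableau T
  open Branch

  record IntroductionOrder (β : Branch T) (_<_ : Rel Term 0ℓ) : Set where
    field
      linear  : IsStrictTotalOrder _≡_ _<_
      extends : ∀ {t t′} n → Occurs (formulas S (at β n)) t →
                ¬ Occurs (formulas S (at β n)) t′ → Occurs (⋃ T β) t′ → t < t′

  C1 : (Branch T → Rel Term 0ℓ) → Set
  C1 < = ∀ β n ρ → rule-at (at β n) ≡ just ρ → ¬ Blocked (< β) (formulas S (at β n)) ρ

  -- Whether (ub′) is possible for ℓ and ℓ′ is judged by their being labels:
  -- its premises ℓ ∶ nom ℓ and ℓ′ ∶ nom ℓ′ then follow by refl, and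
  -- deferring refl must not be a way to defer (ub′).
  C2 : Set
  C2 = ∀ β → OpenBranch T β → ∃[ N ] (∀ n → N ≤ n →
         ∀ ρ → rule-at (at β n) ≡ just ρ → TermProducing (formulas S (at β n)) ρ →
         ∀ ℓ ℓ′ → IsLabel (formulas S (at β n)) ℓ → IsLabel (formulas S (at β n)) ℓ′ →
         ub′ ℓ ℓ′ ∈ˡ applied (at β n))

  -- Each branch β has its own order < β.
  C1C2Derivation : Set₁
  C1C2Derivation =
    Σ[ < ∈ (Branch T → Rel Term 0ℓ) ]
      ((∀ β → IntroductionOrder β (< β)) × C1 < × C2 ×
       FinishedExcept T (λ β → Blocked (< β) (⋃ T β)))

{-# OPTIONS --safe #-}
module Submission where

-- Soundness: interpret f r p ℓ by a chosen r-successor of ℓ in p; every rule then has a true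
-- conclusion, so some branch consists of true formulas.  Completeness: the classes of labels
-- under t ∼ u form a model.  Blocking does no harm there, because the first-introduced member
-- of a class is not blocked and provides the witnesses for the whole class.
--
-- Termination: an open branch yields a model of the input, and filtration makes its set of
-- denotations finite.  Follow the branch of formulas true in the filtrated model.  Once (c2)
-- has taken effect, a term involved in an unblocked term-producing step is either a term of the
-- root or the first of the new terms with its denotation, since an earlier one would have been
-- equated with it by (ub′).  So finitely many terms take part in term-producing steps, whence
-- the branch has finitely many terms, formulas and rule instances.  Finiteness of closed
-- tableaux is König's lemma.

open import Defs
open import Level using (0ℓ)
open import Axiom.ExcludedMiddle using (ExcludedMiddle)
open import Data.Bool using (Bool; true; false)
open import Data.Empty using (⊥; ⊥-elim)
open import Data.Fin using (Fin; zero; suc; #_)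
open import Data.List
  using (List; []; _∷_; _++_; map; length; lookup; concatMap; cartesianProductWith; tabulate;
    allFin)
open import Data.List.Properties using (∷-injective; length-map)
open import Data.List.Membership.Propositional using (find) renaming (_∈_ to _∈ˡ_; _∉_ to _∉ˡ_)
open import Data.List.Membership.Propositional.Properties
  using (∈-++⁺ˡ; ∈-++⁺ʳ; ∈-++⁻; ∈-map⁺; ∈-map⁻; ∈-concatMap⁺; ∈-concatMap⁻;
    ∈-cartesianProductWith⁺; ∈-tabulate⁺; ∈-allFin; finite)
open import Data.List.Relation.Unary.All as All using (All; []; _∷_)
open import Data.List.Relation.Unary.Any as Any using (Any; here; there)
open import Data.Maybe using (just; nothing)
open import Data.Maybe.Properties using (just-injective)
open import Data.Nat
  using (ℕ; zero; suc; _+_; _*_; _≤_; _<_; _≤′_; ≤′-refl; ≤′-step; _≤?_; z≤n; ≤-pred)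
open import Data.Nat.Induction using (<-wellFounded; Acc; acc)
open import Data.Nat.Properties
  using (suc-injective; <-cmp; <⇒≢; n<1+n; +-monoʳ-≤; *-mono-≤; *-suc; +-cancelˡ-≡; m≤m+n; m≤n+m;
    +-comm; ≤-antisym; ≮⇒≥; ≰⇒>; ≤⇒≤′; module ≤-Reasoning)
open import Data.Product using (Σ-syntax; ∃; ∃-syntax; _×_; _,_; proj₁; proj₂; map₂)
open import Data.Sum as Sum using (_⊎_; inj₁; inj₂; [_,_]′)
open import Data.Unit using (⊤; tt)
open import Function.Base using (_∘_; id)
open import Function.Bundles using (mk⇔; mk↣)
open import Function.Definitions using (Injective)
open import Relation.Binary.Core using (Rel)
open import Relation.Binary.Definitions using (tri<; tri≈; tri>; Irreflexive; Transitive)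
open import Relation.Binary.PropositionalEquality using (_≡_; _≢_; refl; cong; cong₂)
  renaming (sym to ≡-sym; trans to ≡-trans; subst to ≡-subst)
open import Relation.Binary.Structures using (IsStrictTotalOrder)
open import Relation.Nullary using (¬_; yes; no; does)
open import Relation.Nullary.Decidable using (decidable-stable; recompute)
open import Relation.Unary using (_∈_; _⊆_)

-- A closure rule has no index `i`, so in a set where every applicable instance is concluded no
-- closure rule is applicable.
Concluded : Formulas → Rule → Set
Concluded Γ ρ = ∃[ i ] All (_∈ Γ) (lookup (conclusions ρ) i)

-- Tableaux and their branches

conclusions-of-applied : ∀ {S ρ} h → ρ ∈ˡ applied h → Concluded (formulas S h) ρ
conclusions-of-applied ((ρ , i) ∷ h) (here refl) = i , All.tabulate inj₂
conclusions-of-applied ((_ , _) ∷ h) (there m)   =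
  let i , all = conclusions-of-applied h m in i , All.map inj₁ all

no-choice : ∀ {ρ} → conclusions ρ ≡ [] → ¬ Choice ρ
no-choice none i with () ← ≡-subst (Fin ∘ length) none i

module _ {S : ConceptSet} (T : Tableau S) where
  open Tableau T

  node-invariant : (P : XConcept → Set) →
    (∀ C → C ∈ S → P (fresh ∶ embed C)) →
    (∀ ρ → All P (premises ρ) → ∀ i → All P (lookup (conclusions ρ) i)) →
    ∀ {h} → Node rule-at h → ∀ φ → φ ∈ formulas S h → P φ
  node-invariant P base closed root _ (C , C∈S , refl) = base C C∈S
  node-invariant P base closed (child ν eq i) φ (inj₁ φ∈) = node-invariant P base closed ν φ φ∈
  node-invariant P base closed (child {ρ = ρ} ν eq i) φ (inj₂ φ∈) =
    All.lookup (closed ρ (All.map (node-invariant P base closed ν _) (applicable ν eq)) i) φ∈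

  step-node : ∀ {h h′} → Node rule-at h → Step T h h′ → Node rule-at h′
  step-node ν (extend eq i) = child ν eq i
  step-node ν (halt _)      = ν

  step-formulas : ∀ {h h′} → Step T h h′ → formulas S h ⊆ formulas S h′
  step-formulas (extend _ _) = inj₁
  step-formulas (halt _)     = id

  step-applied : ∀ {h h′ ρ} → Step T h h′ → ρ ∈ˡ applied h → ρ ∈ˡ applied h′
  step-applied (extend _ _) = there
  step-applied (halt _)     = id

  module _ (β : Branch T) where
    open Branch β

    branch-node : ∀ n → Node rule-at (at n)
    branch-node zero rewrite start = root
    branch-node (suc n) = step-node (branch-node n) (step n)

    branch-formulas : ∀ {m n} → m ≤′ n → formulas S (at m) ⊆ formulas S (at n)
    branch-formulas ≤′-refl       = id
    branch-formulas (≤′-step m≤n) = step-formulas (step _) ∘ branch-formulas m≤n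

    branch-applied : ∀ {m n ρ} → m ≤′ n → ρ ∈ˡ applied (at m) → ρ ∈ˡ applied (at n)
    branch-applied ≤′-refl       = id
    branch-applied (≤′-step m≤n) = step-applied (step _) ∘ branch-applied m≤n

    branch-invariant : (P : XConcept → Set) →
      (∀ C → C ∈ S → P (fresh ∶ embed C)) →
      (∀ ρ → All P (premises ρ) → ∀ i → All P (lookup (conclusions ρ) i)) →
      ∀ φ → φ ∈ ⋃ T β → P φ
    branch-invariant P base closed φ (n , φ∈) = node-invariant P base closed (branch-node n) φ φ∈

    -- A node where a closure rule is applied is a leaf, and the branch halts there; a rule with
    -- conclusions forces a proper step.
    applied-next : ∀ {n ρ} → rule-at (at n) ≡ just ρ → conclusions ρ ≢ [] →
                   ρ ∈ˡ applied (at (suc n))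
    applied-next {n} {ρ} eq nonempty with at (suc n) | step n
    ... | _ | extend eq′ i = here (just-injective (≡-trans (≡-sym eq) eq′))
    ... | _ | halt leaf    = ⊥-elim (nonempty (leaf ρ eq))

    -- Openness rules out that `ρ` is a closure rule, so its application extends the branch and the
    -- conclusion chosen is present one node later.
    saturated : ∀ {Exempt} → FinishedExcept T Exempt → OpenBranch T β →
      ∀ ρ → ¬ Exempt β ρ → Applicable (⋃ T β) ρ → Concluded (⋃ T β) ρ
    saturated fin opn ρ ¬exempt app =
      let n , eq = fin β opn ρ app ¬exempt
          i , all = conclusions-of-applied (at (suc n))
                      (applied-next eq (λ none → opn (ρ , none , n , eq)))
      in i , All.map (suc n ,_) all

-- Terms introduced by the rules

data Produces : Rule → Term → Set where
  ex     : ∀ {ℓ r p} → Produces (ex ℓ r p) (f r p ℓ)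
  f-cong : ∀ {ℓ ℓ′ r p} → Produces (f-cong ℓ ℓ′ r p) (f r p ℓ′)

-- By inspection of the rules: only `ex` and `f-cong` build a compound term, and the proper subterms
-- of that term occur in their premises.
new-term : ∀ ρ i {φ t} → φ ∈ˡ lookup (conclusions ρ) i → t occursIn φ →
           Any (t occursIn_) (premises ρ) ⊎ Produces ρ t
new-term (not-not ℓ p) zero (here refl) (label o) = inj₁ (here (label o))
new-term (not-not ℓ p) zero (here refl) (body o) = inj₁ (here (body (neg (neg o))))
new-term (or ℓ p q) zero (here refl) (label o) = inj₁ (here (label o))
new-term (or ℓ p q) zero (here refl) (body o) = inj₁ (here (body (left o)))
new-term (or ℓ p q) (suc zero) (here refl) (label o) = inj₁ (here (label o))
new-term (or ℓ p q) (suc zero) (here refl) (body o) = inj₁ (here (body (right o)))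
new-term (not-or ℓ p q) zero (here refl) (label o) = inj₁ (here (label o))
new-term (not-or ℓ p q) zero (here refl) (body (neg o)) = inj₁ (here (body (neg (left o))))
new-term (not-or ℓ p q) zero (there (here refl)) (label o) = inj₁ (here (label o))
new-term (not-or ℓ p q) zero (there (here refl)) (body (neg o)) = inj₁ (here (body (neg (right o))))
new-term (ex ℓ r p) zero (here refl) (label o) = inj₁ (here (label o))
new-term (ex ℓ r p) zero (here refl) (body (some (nom here))) = inj₂ ex
new-term (ex ℓ r p) zero (here refl) (body (some (nom (f-con o)))) = inj₁ (here (body (some o)))
new-term (ex ℓ r p) zero (here refl) (body (some (nom (f-arg o)))) = inj₁ (here (label o))
new-term (ex ℓ r p) zero (there (here refl)) (label here) = inj₂ ex
new-term (ex ℓ r p) zero (there (here refl)) (label (f-con o)) = inj₁ (here (body (some o)))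
new-term (ex ℓ r p) zero (there (here refl)) (label (f-arg o)) = inj₁ (here (label o))
new-term (ex ℓ r p) zero (there (here refl)) (body o) = inj₁ (here (body (some o)))
new-term (not-ex ℓ ℓ′ r p) zero (here refl) (label o) = inj₁ (there (here (body (some (nom o)))))
new-term (not-ex ℓ ℓ′ r p) zero (here refl) (body (neg o)) = inj₁ (here (body (neg (some o))))
new-term (trans ℓ ℓ′ ℓ″ r) zero (here refl) (label o) = inj₁ (here (label o))
new-term (trans ℓ ℓ′ ℓ″ r) zero (here refl) (body o) = inj₁ (there (here (body o)))
new-term (sym ℓ ℓ′) zero (here refl) (label o) = inj₁ (here (body (nom o)))
new-term (sym ℓ ℓ′) zero (here refl) (body (nom o)) = inj₁ (here (label o))
new-term (not-nom ℓ ℓ′) zero (here refl) (label o) = inj₁ (here (body (neg (nom o))))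
new-term (not-nom ℓ ℓ′) zero (here refl) (body o) = inj₁ (here (body (neg o)))
new-term (refl ℓ p) zero (here refl) (label o) = inj₁ (here (label o))
new-term (refl ℓ p) zero (here refl) (body (nom o)) = inj₁ (here (label o))
new-term (not-edge ℓ ℓ′ r) zero (here refl) (label o) = inj₁ (here (body (neg (some (nom o)))))
new-term (not-edge ℓ ℓ′ r) zero (here refl) (body o) = inj₁ (here (body (neg (some o))))
new-term (subst ℓ ℓ′ p) zero (here refl) (label o) = inj₁ (there (here (body (nom o))))
new-term (subst ℓ ℓ′ p) zero (here refl) (body o) = inj₁ (here (body o))
new-term (edge ℓ ℓ′ ℓ″ r) zero (here refl) (label o) = inj₁ (here (label o))
new-term (edge ℓ ℓ′ ℓ″ r) zero (here refl) (body (some o)) = inj₁ (there (here (body o)))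
new-term (f-cong ℓ ℓ′ r p) zero (here refl) (label o) = inj₁ (here (label o))
new-term (f-cong ℓ ℓ′ r p) zero (here refl) (body (nom here)) = inj₂ f-cong
new-term (f-cong ℓ ℓ′ r p) zero (here refl) (body (nom (f-con o))) = inj₁ (here (label (f-con o)))
new-term (f-cong ℓ ℓ′ r p) zero (here refl) (body (nom (f-arg o))) = inj₁ (there (here (body (nom o))))
new-term (ub′ ℓ ℓ′) zero (here refl) (label o) = inj₁ (here (label o))
new-term (ub′ ℓ ℓ′) zero (here refl) (body (nom o)) = inj₁ (there (here (label o)))
new-term (ub′ ℓ ℓ′) (suc zero) (here refl) (label o) = inj₁ (here (label o))
new-term (ub′ ℓ ℓ′) (suc zero) (here refl) (body (neg (nom o))) = inj₁ (there (here (label o)))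

module _ {S : ConceptSet} (T : Tableau S) where
  open Tableau T

  -- The conclusions are kept in the result because they show where the new term stands, as a label
  -- or as the right side of an equation.
  step-occurs : ∀ {h h′ t} → Node rule-at h → Step T h h′ → Occurs (formulas S h′) t →
    Occurs (formulas S h) t ⊎
    ∃[ ρ ] ∃[ i ] (rule-at h ≡ just ρ × Produces ρ t ×
                   All (_∈ formulas S h′) (lookup (conclusions ρ) i))
  step-occurs ν (halt _) occ = inj₁ occ
  step-occurs ν (extend eq i) (φ , inj₁ m , o) = inj₁ (φ , m , o)
  step-occurs ν (extend {ρ} eq i) (φ , inj₂ m , o) with new-term ρ i m o
  ... | inj₂ prod = inj₂ (ρ , i , eq , prod , All.tabulate inj₂)
  ... | inj₁ any  = let ψ , ψ∈ , o′ = find any in inj₁ (ψ , All.lookup (applicable ν eq) ψ∈ , o′)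

with-term-occurs : ∀ {φ t} → φ with-term t → t occursIn φ
with-term-occurs label  = label here
with-term-occurs equal  = body (nom here)
with-term-occurs linked = body (some (nom here))

-- The shape and the terms of the formulas on a branch

-- This is used for `Plain`, which the truth lemma needs, and for a finite subconcept closure, which
-- bounds the formulas of a branch.
record SubconceptClosed (Q : XConcept → Set) : Set where
  field
    ¬-closed  : ∀ {C} → Q (¬ᶜ C) → Q C
    ∨-closedˡ : ∀ {C D} → Q (C ∨ᶜ D) → Q C
    ∨-closedʳ : ∀ {C D} → Q (C ∨ᶜ D) → Q D
    ∃-closed  : ∀ {r C} → Q (∃ᶜ r C) → Q C

-- The concepts that can label terms when the input consists of concepts in Q.
data Shape (Q : XConcept → Set) : XConcept → Set where
  sub        : ∀ {C} → Q C → Shape Q C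
  neg        : ∀ {C} → Q C → Shape Q (¬ᶜ C)
  equation   : ∀ {u} → Shape Q (nom u)
  inequation : ∀ {u} → Shape Q (¬ᶜ nom u)
  link       : ∀ {r C u} → Q (∃ᶜ r C) → Shape Q (∃ᶜ r (nom u))

data Shaped (Q : XConcept → Set) : XConcept → Set where
  shaped : ∀ {t C} → Shape Q C → Shaped Q (t ∶ C)

module _ {Q : XConcept → Set} (closed : SubconceptClosed Q) where
  open SubconceptClosed closed

  -- `Shape` is what the rules preserve: `not-or` and `not-ex` negate subconcepts, and the equality
  -- and edge rules only exchange nominals. A `link` retains some `∃ᶜ r C` in `Q` as evidence that
  -- the role `r` comes from the input.
  rule-shaped : ∀ ρ → All (Shaped Q) (premises ρ) → ∀ i → All (Shaped Q) (lookup (conclusions ρ) i)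
  rule-shaped (not-not ℓ p) (shaped (sub m) ∷ []) zero = shaped (sub (¬-closed (¬-closed m))) ∷ []
  rule-shaped (not-not ℓ p) (shaped (neg m) ∷ []) zero = shaped (sub (¬-closed m)) ∷ []
  rule-shaped (or ℓ p q) (shaped (sub m) ∷ []) zero = shaped (sub (∨-closedˡ m)) ∷ []
  rule-shaped (or ℓ p q) (shaped (sub m) ∷ []) (suc zero) = shaped (sub (∨-closedʳ m)) ∷ []
  rule-shaped (not-or ℓ p q) (shaped (sub m) ∷ []) zero =
    shaped (neg (∨-closedˡ (¬-closed m))) ∷ shaped (neg (∨-closedʳ (¬-closed m))) ∷ []
  rule-shaped (not-or ℓ p q) (shaped (neg m) ∷ []) zero =
    shaped (neg (∨-closedˡ m)) ∷ shaped (neg (∨-closedʳ m)) ∷ []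
  rule-shaped (ex ℓ r p) (shaped (sub m) ∷ []) zero =
    shaped (link m) ∷ shaped (sub (∃-closed m)) ∷ []
  rule-shaped (ex ℓ r _) (shaped (link m) ∷ []) zero = shaped (link m) ∷ shaped equation ∷ []
  rule-shaped (not-ex ℓ ℓ′ r p) (shaped (sub m) ∷ _) zero =
    shaped (neg (∃-closed (¬-closed m))) ∷ []
  rule-shaped (not-ex ℓ ℓ′ r p) (shaped (neg m) ∷ _) zero = shaped (neg (∃-closed m)) ∷ []
  rule-shaped (trans ℓ ℓ′ ℓ″ r) (_ ∷ shaped (sub m) ∷ []) zero = shaped (link m) ∷ []
  rule-shaped (trans ℓ ℓ′ ℓ″ r) (_ ∷ shaped (link m) ∷ []) zero = shaped (link m) ∷ []
  rule-shaped (sym ℓ ℓ′) _ zero = shaped equation ∷ []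
  rule-shaped (not-nom ℓ ℓ′) _ zero = shaped equation ∷ []
  rule-shaped (refl ℓ p) _ zero = shaped equation ∷ []
  rule-shaped (not-edge ℓ ℓ′ r) _ zero = shaped equation ∷ []
  rule-shaped (subst ℓ ℓ′ p) (shaped s ∷ _) zero = shaped s ∷ []
  rule-shaped (edge ℓ ℓ′ ℓ″ r) (shaped (sub m) ∷ _) zero = shaped (link m) ∷ []
  rule-shaped (edge ℓ ℓ′ ℓ″ r) (shaped (link m) ∷ _) zero = shaped (link m) ∷ []
  rule-shaped (f-cong ℓ ℓ′ r p) _ zero = shaped equation ∷ []
  rule-shaped (ub′ ℓ ℓ′) _ zero = shaped equation ∷ []
  rule-shaped (ub′ ℓ ℓ′) _ (suc zero) = shaped inequation ∷ []

  module _ {S : ConceptSet} (T : Tableau S) (S⊆Q : ∀ C → C ∈ S → Q (embed C)) (β : Branch T) where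

    branch-shaped : ∀ {φ} → φ ∈ ⋃ T β → Shaped Q φ
    branch-shaped {φ} =
      branch-invariant T β (Shaped Q) (λ C C∈S → shaped (sub (S⊆Q C C∈S))) rule-shaped φ

-- Concepts with `_∶_` are excluded since no rule decomposes them. Terms inside nominals are not
-- inspected.
Plain : XConcept → Set
Plain (atom p) = ⊤
Plain (nom t)  = ⊤
Plain (¬ᶜ C)   = Plain C
Plain (C ∨ᶜ D) = Plain C × Plain D
Plain (∃ᶜ r C) = Plain C
Plain (t ∶ C)  = ⊥

plain-closed : SubconceptClosed Plain
plain-closed = record { ¬-closed = id ; ∨-closedˡ = proj₁ ; ∨-closedʳ = proj₂ ; ∃-closed = id }

embed-plain : ∀ C → Plain (embed C)
embed-plain (atom p) = tt
embed-plain (nom n)  = tt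
embed-plain (¬ᶜ C)   = embed-plain C
embed-plain (C ∨ᶜ D) = embed-plain C , embed-plain D
embed-plain (∃ᶜ r C) = embed-plain C

shape-plain : ∀ {C} → Shape Plain C → Plain C
shape-plain (sub pl)   = pl
shape-plain (neg pl)   = pl
shape-plain equation   = tt
shape-plain inequation = tt
shape-plain (link pl)  = tt

module _ {S : ConceptSet} (T : Tableau S) (β : Branch T) where
  open Branch β

  branch-plain : ∀ {t C} → (t ∶ C) ∈ ⋃ T β → Plain C
  branch-plain m with branch-shaped plain-closed T (λ C _ → embed-plain C) β m
  ... | shaped s = shape-plain s

  root-formula : ∀ {C} → C ∈ S → (fresh ∶ embed C) ∈ ⋃ T β
  root-formula C∈S =
    0 , ≡-subst (λ h → formulas S h _) (≡-sym start) (_ , C∈S , refl)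

termsᵗ : Term → List Term
terms  : XConcept → List Term

termsᵗ (ind n)   = ind n ∷ []
termsᵗ fresh     = fresh ∷ []
termsᵗ (f r C t) = f r C t ∷ terms C ++ termsᵗ t

terms (atom p) = []
terms (nom t)  = termsᵗ t
terms (¬ᶜ C)   = terms C
terms (C ∨ᶜ D) = terms C ++ terms D
terms (∃ᶜ r C) = terms C
terms (t ∶ C)  = termsᵗ t ++ terms C

termsᵗ-complete : ∀ {t u} → t occursInᵗ u → t ∈ˡ termsᵗ u
terms-complete  : ∀ {t C} → t occursIn C → t ∈ˡ terms C

termsᵗ-complete {ind n} here   = here refl
termsᵗ-complete {fresh} here   = here refl
termsᵗ-complete {f r C t} here = here refl
termsᵗ-complete (f-con o)      = there (∈-++⁺ˡ (terms-complete o))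
termsᵗ-complete (f-arg {C = C} o) = there (∈-++⁺ʳ (terms C) (termsᵗ-complete o))

terms-complete (nom o)   = termsᵗ-complete o
terms-complete (neg o)   = terms-complete o
terms-complete (left o)  = ∈-++⁺ˡ (terms-complete o)
terms-complete (right {C = C} o) = ∈-++⁺ʳ (terms C) (terms-complete o)
terms-complete (some o)  = terms-complete o
terms-complete (label o) = ∈-++⁺ˡ (termsᵗ-complete o)
terms-complete (body {u = u} o)  = ∈-++⁺ʳ (termsᵗ u) (terms-complete o)

module _ {S : ConceptSet} (Cs : List Concept) (S⊆Cs : S ⊆ (_∈ˡ Cs)) where

  -- This is an upper bound and not an enumeration: `Cs` may list concepts outside `S`.
  stageFormulas : History → List XConcept
  stageFormulas []            = map (λ C → fresh ∶ embed C) Cs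
  stageFormulas ((ρ , i) ∷ h) = lookup (conclusions ρ) i ++ stageFormulas h

  stageFormulas-complete : ∀ h {φ} → φ ∈ formulas S h → φ ∈ˡ stageFormulas h
  stageFormulas-complete [] (C , C∈S , refl) = ∈-map⁺ _ (S⊆Cs C∈S)
  stageFormulas-complete ((ρ , i) ∷ h) (inj₁ m) =
    ∈-++⁺ʳ (lookup (conclusions ρ) i) (stageFormulas-complete h m)
  stageFormulas-complete ((ρ , i) ∷ h) (inj₂ m) = ∈-++⁺ˡ m

  stageTerms : History → List Term
  stageTerms h = concatMap terms (stageFormulas h)

  stageTerms-complete : ∀ h {t} → Occurs (formulas S h) t → t ∈ˡ stageTerms h
  stageTerms-complete h (φ , m , o) =
    ∈-concatMap⁺ terms (Any.map (λ { refl → terms-complete o }) (stageFormulas-complete h m))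

-- A concept of a given shape is determined by the input concepts up to one nominal; `Target`
-- singles out the term in it.
data Target : XConcept → Term → Set where
  equation   : ∀ {u} → Target (nom u) u
  inequation : ∀ {u} → Target (¬ᶜ nom u) u
  link       : ∀ {r u} → Target (∃ᶜ r (nom u)) u

target-occurs : ∀ {C u} → Target C u → u occursIn C
target-occurs equation   = nom here
target-occurs inequation = neg (nom here)
target-occurs link       = some (nom here)

-- Meant for concepts ∃ᶜ r _; the last clause is junk.
retarget : XConcept → Term → XConcept
retarget (∃ᶜ r _) u = ∃ᶜ r (nom u)
retarget C        _ = C

distinct : Term → XConcept
distinct u = ¬ᶜ nom u

shapes : List XConcept → List Term → List XConcept
shapes Ks us =
  Ks ++ map ¬ᶜ_ Ks ++ map nom us ++ map distinct us ++ cartesianProductWith retarget Ks us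

shapes-complete : ∀ {Ks us C} → Shape (_∈ˡ Ks) C → (∀ {u} → Target C u → u ∈ˡ us) →
                  C ∈ˡ shapes Ks us
shapes-complete (sub m) _ = ∈-++⁺ˡ m
shapes-complete {Ks} (neg m) _ = ∈-++⁺ʳ Ks (∈-++⁺ˡ (∈-map⁺ ¬ᶜ_ m))
shapes-complete {Ks} equation tgt =
  ∈-++⁺ʳ Ks (∈-++⁺ʳ (map ¬ᶜ_ Ks) (∈-++⁺ˡ (∈-map⁺ nom (tgt equation))))
shapes-complete {Ks} {us} inequation tgt =
  ∈-++⁺ʳ Ks (∈-++⁺ʳ (map ¬ᶜ_ Ks) (∈-++⁺ʳ (map nom us) (∈-++⁺ˡ (∈-map⁺ distinct (tgt inequation)))))
-- From the concept `∃ᶜ r C` in `Ks` only the role survives; `retarget` replaces `C` by the nominal.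
shapes-complete {Ks} {us} (link m) tgt =
  ∈-++⁺ʳ Ks (∈-++⁺ʳ (map ¬ᶜ_ Ks) (∈-++⁺ʳ (map nom us) (∈-++⁺ʳ (map distinct us)
    (∈-cartesianProductWith⁺ retarget m (tgt link)))))

-- Finitely many formulas admit finitely many rule instances

words : {A : Set} → ℕ → List A → List (List A)
words zero    xs = [] ∷ []
words (suc n) xs = cartesianProductWith _∷_ xs (words n xs)

words-complete : {A : Set} {xs ys : List A} → All (_∈ˡ xs) ys → ys ∈ˡ words (length ys) xs
words-complete []       = here refl
words-complete (m ∷ ms) = ∈-cartesianProductWith⁺ _∷_ m (words-complete ms)

tag : Rule → Fin 15
tag (not-not _ _)    = # 0
tag (or _ _ _)       = # 1
tag (not-or _ _ _)   = # 2
tag (ex _ _ _)       = # 3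
tag (not-ex _ _ _ _) = # 4
tag (trans _ _ _ _)  = # 5
tag (sym _ _)        = # 6
tag (not-nom _ _)    = # 7
tag (refl _ _)       = # 8
tag (not-edge _ _ _) = # 9
tag (subst _ _ _)    = # 10
tag (edge _ _ _ _)   = # 11
tag (f-cong _ _ _ _) = # 12
tag (closure _ _)    = # 13
tag (ub′ _ _)        = # 14

-- Counting instances is reduced to counting keys: the premises form a word of length one or two
-- over the available formulas.
key : Rule → Fin 15 × List XConcept
key ρ = tag ρ , premises ρ

key-injective : ∀ {ρ ρ′} → key ρ ≡ key ρ′ → ρ ≡ ρ′
key-injective {not-not _ _} {not-not _ _} refl = refl
key-injective {or _ _ _} {or _ _ _} refl = refl
key-injective {not-or _ _ _} {not-or _ _ _} refl = refl
key-injective {ex _ _ _} {ex _ _ _} refl = refl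
key-injective {not-ex _ _ _ _} {not-ex _ _ _ _} refl = refl
key-injective {trans _ _ _ _} {trans _ _ _ _} refl = refl
key-injective {sym _ _} {sym _ _} refl = refl
key-injective {not-nom _ _} {not-nom _ _} refl = refl
key-injective {refl _ _} {refl _ _} refl = refl
key-injective {not-edge _ _ _} {not-edge _ _ _} refl = refl
key-injective {subst _ _ _} {subst _ _ _} refl = refl
key-injective {edge _ _ _ _} {edge _ _ _ _} refl = refl
key-injective {f-cong _ _ _ _} {f-cong _ _ _ _} refl = refl
key-injective {closure _ _} {closure _ _} refl = refl
key-injective {ub′ _ _} {ub′ _ _} refl = refl

premises-length : ∀ ρ → length (premises ρ) ≡ 1 ⊎ length (premises ρ) ≡ 2
premises-length (not-not _ _)    = inj₁ refl
premises-length (or _ _ _)       = inj₁ refl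
premises-length (not-or _ _ _)   = inj₁ refl
premises-length (ex _ _ _)       = inj₁ refl
premises-length (not-ex _ _ _ _) = inj₂ refl
premises-length (trans _ _ _ _)  = inj₂ refl
premises-length (sym _ _)        = inj₁ refl
premises-length (not-nom _ _)    = inj₁ refl
premises-length (refl _ _)       = inj₁ refl
premises-length (not-edge _ _ _) = inj₁ refl
premises-length (subst _ _ _)    = inj₂ refl
premises-length (edge _ _ _ _)   = inj₂ refl
premises-length (f-cong _ _ _ _) = inj₂ refl
premises-length (closure _ _)    = inj₂ refl
premises-length (ub′ _ _)        = inj₂ refl

keys : List XConcept → List (Fin 15 × List XConcept)
keys φs = cartesianProductWith _,_ (allFin 15) (words 1 φs ++ words 2 φs)

keys-complete : ∀ {φs} ρ → All (_∈ˡ φs) (premises ρ) → key ρ ∈ˡ keys φs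
keys-complete {φs} ρ all = ∈-cartesianProductWith⁺ _,_ (∈-allFin (tag ρ)) (case (premises-length ρ))
  where
  word : ∀ {n} → length (premises ρ) ≡ n → premises ρ ∈ˡ words n φs
  word eq = ≡-subst (λ n → premises ρ ∈ˡ words n φs) eq (words-complete all)
  case : length (premises ρ) ≡ 1 ⊎ length (premises ρ) ≡ 2 → premises ρ ∈ˡ words 1 φs ++ words 2 φs
  case (inj₁ eq) = ∈-++⁺ˡ (word eq)
  case (inj₂ eq) = ∈-++⁺ʳ (words 1 φs) (word eq)

-- Subconcept closure

subconcepts : Concept → List Concept
subconcepts (atom p) = atom p ∷ []
subconcepts (nom n)  = nom n ∷ []
subconcepts (¬ᶜ C)   = ¬ᶜ C ∷ subconcepts C
subconcepts (C ∨ᶜ D) = C ∨ᶜ D ∷ subconcepts C ++ subconcepts D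
subconcepts (∃ᶜ r C) = ∃ᶜ r C ∷ subconcepts C

subconcepts-refl : ∀ C → C ∈ˡ subconcepts C
subconcepts-refl (atom p) = here refl
subconcepts-refl (nom n)  = here refl
subconcepts-refl (¬ᶜ C)   = here refl
subconcepts-refl (C ∨ᶜ D) = here refl
subconcepts-refl (∃ᶜ r C) = here refl

subconcepts-trans : ∀ {C D} E → D ∈ˡ subconcepts E → C ∈ˡ subconcepts D → C ∈ˡ subconcepts E
subconcepts-trans (atom p) (here refl) m = m
subconcepts-trans (nom n)  (here refl) m = m
subconcepts-trans (¬ᶜ E)   (here refl) m = m
subconcepts-trans (¬ᶜ E)   (there m) m′  = there (subconcepts-trans E m m′)
subconcepts-trans (E ∨ᶜ F) (here refl) m = m
subconcepts-trans (E ∨ᶜ F) (there m) m′ with ∈-++⁻ (subconcepts E) m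
... | inj₁ m-E = there (∈-++⁺ˡ (subconcepts-trans E m-E m′))
... | inj₂ m-F = there (∈-++⁺ʳ (subconcepts E) (subconcepts-trans F m-F m′))
subconcepts-trans (∃ᶜ r E) (here refl) m = m
subconcepts-trans (∃ᶜ r E) (there m) m′  = there (subconcepts-trans E m m′)

module Closure (Cs : List Concept) where

  closureList : List Concept
  closureList = concatMap subconcepts Cs

  closureList-⊇ : ∀ {C} → C ∈ˡ Cs → C ∈ˡ closureList
  closureList-⊇ m = ∈-concatMap⁺ subconcepts (Any.map (λ { refl → subconcepts-refl _ }) m)

  closureList-closed : ∀ {C D} → C ∈ˡ subconcepts D → D ∈ˡ closureList → C ∈ˡ closureList
  closureList-closed m m′ = ∈-concatMap⁺ subconcepts
    (Any.map (λ {E} m″ → subconcepts-trans E m″ m) (∈-concatMap⁻ subconcepts {xs = Cs} m′))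

  ¬-closed  : ∀ {C} → ¬ᶜ C ∈ˡ closureList → C ∈ˡ closureList
  ¬-closed = closureList-closed (there (subconcepts-refl _))
  ∨-closedˡ : ∀ {C D} → C ∨ᶜ D ∈ˡ closureList → C ∈ˡ closureList
  ∨-closedˡ = closureList-closed (there (∈-++⁺ˡ (subconcepts-refl _)))
  ∨-closedʳ : ∀ {C D} → C ∨ᶜ D ∈ˡ closureList → D ∈ˡ closureList
  ∨-closedʳ {C} = closureList-closed (there (∈-++⁺ʳ (subconcepts C) (subconcepts-refl _)))
  ∃-closed  : ∀ {r C} → ∃ᶜ r C ∈ˡ closureList → C ∈ˡ closureList
  ∃-closed = closureList-closed (there (subconcepts-refl _))

  embeddedClosure : List XConcept
  embeddedClosure = map embed closureList

  embedded-closed : SubconceptClosed (_∈ˡ embeddedClosure)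
  embedded-closed = record
    { ¬-closed  = λ m → ¬-case (∈-map⁻ embed m)
    ; ∨-closedˡ = λ m → ∨-caseˡ (∈-map⁻ embed m)
    ; ∨-closedʳ = λ m → ∨-caseʳ (∈-map⁻ embed m)
    ; ∃-closed  = λ m → ∃-case (∈-map⁻ embed m)
    }
    where
    ¬-case : ∀ {C} → ∃[ D ] (D ∈ˡ closureList × ¬ᶜ C ≡ embed D) → C ∈ˡ embeddedClosure
    ¬-case (¬ᶜ D , m , refl) = ∈-map⁺ embed (¬-closed m)
    ∨-caseˡ : ∀ {C C′} → ∃[ D ] (D ∈ˡ closureList × C ∨ᶜ C′ ≡ embed D) → C ∈ˡ embeddedClosure
    ∨-caseˡ (D ∨ᶜ D′ , m , refl) = ∈-map⁺ embed (∨-closedˡ m)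
    ∨-caseʳ : ∀ {C C′} → ∃[ D ] (D ∈ˡ closureList × C ∨ᶜ C′ ≡ embed D) → C′ ∈ˡ embeddedClosure
    ∨-caseʳ (D ∨ᶜ D′ , m , refl) = ∈-map⁺ embed (∨-closedʳ m)
    ∃-case : ∀ {r C} → ∃[ D ] (D ∈ˡ closureList × ∃ᶜ r C ≡ embed D) → C ∈ˡ embeddedClosure
    ∃-case (∃ᶜ r D , m , refl) = ∈-map⁺ embed (∃-closed m)

-- An injective numbering of the terms

-- Since a ≤ a + b, the value is at least (a + b)² and below (a + b + 1)², which determines a + b.
pair : ℕ → ℕ → ℕ
pair a b = (a + b) * (a + b) + a

pair-mono-< : ∀ a b c d → a + b < c + d → pair a b < pair c d
pair-mono-< a b c d a+b<c+d = begin-strict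
  s * s + a              ≤⟨ +-monoʳ-≤ (s * s) (m≤m+n a b) ⟩
  s * s + s              ≡⟨ +-comm (s * s) s ⟩
  s + s * s              ≡⟨ *-suc s s ⟨
  s * suc s              ≤⟨ m≤n+m (s * suc s) s ⟩
  s + s * suc s          <⟨ n<1+n _ ⟩
  suc s * suc s          ≤⟨ *-mono-≤ a+b<c+d a+b<c+d ⟩
  (c + d) * (c + d)      ≤⟨ m≤m+n _ c ⟩
  (c + d) * (c + d) + c  ∎
  where
  open ≤-Reasoning

  s = a + b

pair-injective : ∀ a b c d → pair a b ≡ pair c d → a ≡ c × b ≡ d
pair-injective a b c d eq with <-cmp (a + b) (c + d)
... | tri< lt _ _ = ⊥-elim (<⇒≢ (pair-mono-< a b c d lt) eq)
... | tri> _ _ gt = ⊥-elim (<⇒≢ (pair-mono-< c d a b gt) (≡-sym eq))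
... | tri≈ _ s≡s′ _ = a≡c , +-cancelˡ-≡ a b d (≡-trans s≡s′ (cong (_+ d) (≡-sym a≡c)))
  where
  a≡c : a ≡ c
  a≡c = +-cancelˡ-≡ ((c + d) * (c + d)) a c (≡-trans (cong (λ s → s * s + a) (≡-sym s≡s′)) eq)

-- Terms and concepts are mutually recursive; passing through one type of labelled trees leaves a
-- single recursion for the injectivity of the numbering.
data Tree : Set where
  tip  : Tree
  fork : ℕ → Tree → Tree → Tree

treeCode : Tree → ℕ
treeCode tip          = 0
treeCode (fork n s t) = suc (pair n (pair (treeCode s) (treeCode t)))

treeCode-injective : Injective _≡_ _≡_ treeCode
treeCode-injective {tip} {tip} _ = refl
treeCode-injective {fork n s t} {fork n′ s′ t′} eq
  with refl , eq′ ← pair-injective n _ n′ _ (suc-injective eq)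
  with eq-s , eq-t ← pair-injective (treeCode s) _ (treeCode s′) _ eq′
  = cong₂ (fork n) (treeCode-injective eq-s) (treeCode-injective eq-t)

number : ℕ → Tree
number n = fork n tip tip

-- The label of a `fork` tells the constructors apart, and `suc r` leaves the label 0 to `ind`.
termTree    : Term → Tree
conceptTree : XConcept → Tree

termTree (ind n)   = fork 0 (number n) tip
termTree fresh     = tip
termTree (f r C t) = fork (suc r) (conceptTree C) (termTree t)

conceptTree (atom p) = fork 0 (number p) tip
conceptTree (nom t)  = fork 1 (termTree t) tip
conceptTree (¬ᶜ C)   = fork 2 (conceptTree C) tip
conceptTree (C ∨ᶜ D) = fork 3 (conceptTree C) (conceptTree D)
conceptTree (∃ᶜ r C) = fork 4 (number r) (conceptTree C)
conceptTree (t ∶ C)  = fork 5 (termTree t) (conceptTree C)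

fork-injective : ∀ {m n s s′ t t′} → fork m s t ≡ fork n s′ t′ → m ≡ n × s ≡ s′ × t ≡ t′
fork-injective refl = refl , refl , refl

termTree-injective    : ∀ t u → termTree t ≡ termTree u → t ≡ u
conceptTree-injective : ∀ C D → conceptTree C ≡ conceptTree D → C ≡ D

termTree-injective (ind n) (ind .n) refl = refl
termTree-injective fresh fresh _ = refl
termTree-injective (f r C t) (f s D u) eq
  with refl , eq₁ , eq₂ ← fork-injective eq
  = cong₂ (f r) (conceptTree-injective C D eq₁) (termTree-injective t u eq₂)

conceptTree-injective (atom p) (atom .p) refl = refl
conceptTree-injective (nom t) (nom u) eq with _ , eq₁ , _ ← fork-injective eq =
  cong nom (termTree-injective t u eq₁)
conceptTree-injective (¬ᶜ C) (¬ᶜ D) eq with _ , eq₁ , _ ← fork-injective eq =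
  cong ¬ᶜ_ (conceptTree-injective C D eq₁)
conceptTree-injective (C ∨ᶜ C′) (D ∨ᶜ D′) eq with _ , eq₁ , eq₂ ← fork-injective eq =
  cong₂ _∨ᶜ_ (conceptTree-injective C D eq₁) (conceptTree-injective C′ D′ eq₂)
conceptTree-injective (∃ᶜ r C) (∃ᶜ s D) eq with _ , refl , eq₂ ← fork-injective eq =
  cong (∃ᶜ r) (conceptTree-injective C D eq₂)
conceptTree-injective (t ∶ C) (u ∶ D) eq with _ , eq₁ , eq₂ ← fork-injective eq =
  cong₂ _∶_ (termTree-injective t u eq₁) (conceptTree-injective C D eq₂)

-- Codes serve to pick one member, that of least code, from each class of equated terms.
code : Term → ℕ
code = treeCode ∘ termTree

code-injective : ∀ {t u} → code t ≡ code u → t ≡ u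
code-injective {t} {u} = termTree-injective t u ∘ treeCode-injective

-- Hintikka sets

-- The quantifier over `Γ` excludes `ex` and every `f-cong`, each being term-producing for some `Γ`.
-- The remaining rules are never blocked, so this property survives (c1).
StaticallySaturated : Formulas → Set₁
StaticallySaturated B =
  ∀ ρ → (∀ {Γ} → ¬ TermProducing Γ ρ) → All (_∈ B) (premises ρ) → Concluded B ρ

-- The field `witness` stands in for `ex`: any label may be the witness, since on a branch with
-- blocking it need not be the term `f r C t`.
record Hintikka (B : Formulas) : Set₁ where
  field
    inhabited : ∃[ t ] IsLabel B t
    plain     : ∀ {t C} → (t ∶ C) ∈ B → Plain C
    static    : StaticallySaturated B
    witness   : ∀ {t r C} → (t ∶ ∃ᶜ r C) ∈ B →
                ∃[ u ] ((t ∶ ∃ᶜ r (nom u)) ∈ B × (u ∶ C) ∈ B)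

module Equality {B : Formulas} (static : StaticallySaturated B) where

  infix 4 _∼_
  _∼_ : Term → Term → Set
  t ∼ u = (t ∶ nom u) ∈ B

  member-refl : ∀ {t C} → (t ∶ C) ∈ B → t ∼ t
  member-refl m with static (refl _ _) (λ ()) (m ∷ [])
  ... | zero , m′ ∷ [] = m′

  ∼-refl : ∀ {t} → IsLabel B t → t ∼ t
  ∼-refl (_ , m) = member-refl m

  ∼-sym : ∀ {t u} → t ∼ u → u ∼ t
  ∼-sym m with static (sym _ _) (λ ()) (m ∷ [])
  ... | zero , m′ ∷ [] = m′

  ∼-subst : ∀ {t u C} → t ∼ u → (t ∶ C) ∈ B → (u ∶ C) ∈ B
  ∼-subst eq m with static (subst _ _ _) (λ ()) (m ∷ eq ∷ [])
  ... | zero , m′ ∷ [] = m′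

  ∼-trans : ∀ {t u v} → t ∼ u → u ∼ v → t ∼ v
  ∼-trans eq eq′ = ∼-subst (∼-sym eq) eq′

  edge-target : ∀ {t u v r} → (t ∶ ∃ᶜ r (nom u)) ∈ B → u ∼ v → (t ∶ ∃ᶜ r (nom v)) ∈ B
  edge-target m eq with static (edge _ _ _ _) (λ ()) (m ∷ eq ∷ [])
  ... | zero , m′ ∷ [] = m′

-- Satisfaction of input concepts, and auxiliary functions

module _ (J : TermModel) where
  open TermModel J using (Δ; model; den-ind)

  embed⇒ : ∀ C {d} → ⟦ J ⟧ˣ (embed C) d → ⟦ model ⟧ C d
  embed⇐ : ∀ C {d} → ⟦ model ⟧ C d → ⟦ J ⟧ˣ (embed C) d

  embed⇒ (atom p) h             = h
  embed⇒ (nom n)  h             = ≡-trans h (den-ind n)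
  embed⇒ (¬ᶜ C)   h             = h ∘ embed⇐ C
  embed⇒ (C ∨ᶜ D) (inj₁ h)      = inj₁ (embed⇒ C h)
  embed⇒ (C ∨ᶜ D) (inj₂ h)      = inj₂ (embed⇒ D h)
  embed⇒ (∃ᶜ r C) (e , rel , h) = e , rel , embed⇒ C h

  embed⇐ (atom p) h             = h
  embed⇐ (nom n)  h             = ≡-trans h (≡-sym (den-ind n))
  embed⇐ (¬ᶜ C)   h             = h ∘ embed⇒ C
  embed⇐ (C ∨ᶜ D) (inj₁ h)      = inj₁ (embed⇐ C h)
  embed⇐ (C ∨ᶜ D) (inj₂ h)      = inj₂ (embed⇐ D h)
  embed⇐ (∃ᶜ r C) (e , rel , h) = e , rel , embed⇐ C h

-- An empty input yields no labels and hence no canonical model, so termination treats it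
-- separately.
empty-satisfiable : ∀ {S} → ¬ ∃ S → Satisfiable S
empty-satisfiable empty =
  record { Δ = ⊤ ; ind = λ _ → tt ; conc = λ _ _ → ⊥ ; role = λ _ _ _ → ⊥ ; role-trans = λ _ () } ,
  tt , λ C C∈S → ⊥-elim (empty (C , C∈S))

map-≡⇒≗ : {A B : Set} {g h : A → B} {xs : List A} → map g xs ≡ map h xs →
          ∀ {x} → x ∈ˡ xs → g x ≡ h x
map-≡⇒≗ eq (here refl) = proj₁ (∷-injective eq)
map-≡⇒≗ eq (there m)   = map-≡⇒≗ (proj₂ (∷-injective eq)) m

-- The terms created by ex from ℓ ∶ ∃ᶜ r p and by f-cong from f r p _ and ℓ; the last clauses
-- are junk.
produce : XConcept → Term → Term
produce (∃ᶜ r p) ℓ = f r p ℓ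
produce _        ℓ = ℓ

reargue : Term → Term → Term
reargue (f r p _) ℓ = f r p ℓ
reargue _         ℓ = ℓ

module _ (em : ExcludedMiddle 0ℓ) where

  -- Classical choice and minimal elements

  by-contradiction : {P : Set} → ¬ ¬ P → P
  by-contradiction = decidable-stable em

  module _ {A : Set} where

    -- Excluded middle for `∃ P` delivers a witness. As a function of its arguments, `choose` gives
    -- equal predicates equal values, which makes `f-cong` sound.
    choose : A → (A → Set) → A
    choose default P with em {∃ P}
    ... | yes (a , _) = a
    ... | no _        = default

    choose-satisfies : ∀ {default} (P : A → Set) → ∃ P → P (choose default P)
    choose-satisfies P ∃p with em {∃ P}
    ... | yes (_ , p) = p
    ... | no ¬∃p      = ⊥-elim (¬∃p ∃p)

    choose-closed : ∀ {default P} (Q : A → Set) → Q default → (∀ a → P a → Q a) →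
                    Q (choose default P)
    choose-closed {P = P} Q q P⇒Q with em {∃ P}
    ... | yes (a , p) = P⇒Q a p
    ... | no _        = q

  least : {A : Set} (μ : A → ℕ) (P : A → Set) → ∃ P →
          ∃[ a ] (P a × (∀ b → P b → μ a ≤ μ b))
  least {A} μ P (a , p) = descend a p (<-wellFounded (μ a))
    where
    descend : ∀ a → P a → Acc _<_ (μ a) → ∃[ a ] (P a × (∀ b → P b → μ a ≤ μ b))
    descend a p (acc smaller) with em {∃[ b ] (P b × μ b < μ a)}
    ... | yes (b , q , lt) = descend b q (smaller lt)
    ... | no none          = a , p , λ b q → ≮⇒≥ (λ lt → none (b , q , lt))

  -- Without well-foundedness, minimality is claimed only against finitely many candidates: the
  -- current element is replaced whenever a candidate in `P` lies below it.
  minimal : {A : Set} {_<_ : Rel A 0ℓ} → Irreflexive _≡_ _<_ → Transitive _<_ →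
            (P : A → Set) → ∃ P → ∀ xs →
            ∃[ m ] (P m × (∀ y → y ∈ˡ xs → P y → ¬ y < m))
  minimal irr tra P (a , p) [] = a , p , λ _ ()
  minimal {_<_ = _<_} irr tra P ∃p (x ∷ xs) with minimal irr tra P ∃p xs
  ... | m , pm , least-m with em {P x × x < m}
  ...   | yes (px , x<m) = x , px , λ
    { y (here refl) _ y<x → irr refl y<x
    ; y (there y∈xs) py y<x → least-m y y∈xs py (tra y<x x<m) }
  ...   | no ¬smaller = m , pm , λ
    { y (here refl) py y<m → ¬smaller (py , y<m)
    ; y (there y∈xs) py y<m → least-m y y∈xs py y<m }

  -- Soundness: a branch through formulas true in a given model

  module Guide (I : Model) (x : Model.Δ I) where
    open Model I hiding (ind)

    -- Denotation and truth are defined together, because the value of `f r C t` depends on the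
    -- truth of `C`, which may itself contain terms.
    den   : Term → Δ
    Holds : XConcept → Δ → Set

    den (ind n)   = Model.ind I n
    den fresh     = x
    -- The default `x` serves when no such successor exists. The value depends on `t` only through
    -- `den t`.
    den (f r C t) = choose x (λ d → role r (den t) d × Holds C d)

    Holds (atom p) d = conc p d
    Holds (nom t)  d = d ≡ den t
    Holds (¬ᶜ C)   d = ¬ Holds C d
    Holds (C ∨ᶜ D) d = Holds C d ⊎ Holds D d
    Holds (∃ᶜ r C) d = ∃[ e ] (role r d e × Holds C e)
    Holds (t ∶ C)  d = Holds C (den t)

    -- Tableau formulas have the form t ∶ C, whose truth value does not depend on the point.
    True : XConcept → Set
    True φ = Holds φ x

    -- A value of `f` is the default `x` or the target of an edge. With `Q` the fixed points of a
    -- filtration, this confines all denotations to a finite set.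
    den-closed : (Q : Δ → Set) → Q x → (∀ n → Q (Model.ind I n)) →
                 (∀ {r d e} → role r d e → Q e) → ∀ t → Q (den t)
    den-closed Q q-x q-ind q-role (ind n)   = q-ind n
    den-closed Q q-x q-ind q-role fresh     = q-x
    den-closed Q q-x q-ind q-role (f r C t) = choose-closed Q q-x (λ _ → q-role ∘ proj₁)

    holds⇒ : ∀ C {d} → Holds (embed C) d → ⟦ I ⟧ C d
    holds⇐ : ∀ C {d} → ⟦ I ⟧ C d → Holds (embed C) d

    holds⇒ (atom p) h             = h
    holds⇒ (nom n)  h             = h
    holds⇒ (¬ᶜ C)   h             = h ∘ holds⇐ C
    holds⇒ (C ∨ᶜ D) (inj₁ h)      = inj₁ (holds⇒ C h)
    holds⇒ (C ∨ᶜ D) (inj₂ h)      = inj₂ (holds⇒ D h)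
    holds⇒ (∃ᶜ r C) (e , rel , h) = e , rel , holds⇒ C h

    holds⇐ (atom p) h             = h
    holds⇐ (nom n)  h             = h
    holds⇐ (¬ᶜ C)   h             = h ∘ holds⇒ C
    holds⇐ (C ∨ᶜ D) (inj₁ h)      = inj₁ (holds⇐ C h)
    holds⇐ (C ∨ᶜ D) (inj₂ h)      = inj₂ (holds⇐ D h)
    holds⇐ (∃ᶜ r C) (e , rel , h) = e , rel , holds⇐ C h

    rule-sound : ∀ ρ → All True (premises ρ) → ∃[ i ] All True (lookup (conclusions ρ) i)
    rule-sound (not-not ℓ p) (h ∷ [])         = zero , by-contradiction h ∷ []
    rule-sound (or ℓ p q) (inj₁ h ∷ [])       = zero , h ∷ []
    rule-sound (or ℓ p q) (inj₂ h ∷ [])       = suc zero , h ∷ []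
    rule-sound (not-or ℓ p q) (h ∷ [])        = zero , h ∘ inj₁ ∷ h ∘ inj₂ ∷ []
    rule-sound (ex ℓ r p) (h ∷ [])            =
      let rel , h′ = choose-satisfies (λ d → role r (den ℓ) d × Holds p d) h
      in zero , (_ , rel , refl) ∷ h′ ∷ []
    rule-sound (not-ex ℓ ℓ′ r p) (h ∷ (_ , rel , refl) ∷ []) =
      zero , (λ h′ → h (_ , rel , h′)) ∷ []
    rule-sound (trans ℓ ℓ′ ℓ″ r) ((_ , rel , refl) ∷ (_ , rel′ , refl) ∷ []) =
      zero , (_ , role-trans r rel rel′ , refl) ∷ []
    rule-sound (sym ℓ ℓ′) (eq ∷ [])           = zero , ≡-sym eq ∷ []
    rule-sound (not-nom ℓ ℓ′) _               = zero , refl ∷ []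
    rule-sound (refl ℓ p) _                   = zero , refl ∷ []
    rule-sound (not-edge ℓ ℓ′ r) _            = zero , refl ∷ []
    rule-sound (subst ℓ ℓ′ p) (h ∷ eq ∷ [])   = zero , ≡-subst (Holds p) eq h ∷ []
    rule-sound (edge ℓ ℓ′ ℓ″ r) ((_ , rel , eq) ∷ eq′ ∷ []) =
      zero , (_ , rel , ≡-trans eq eq′) ∷ []
    -- Equal denotations of `ℓ` and `ℓ′` give the same predicate, hence the same chosen element.
    rule-sound (f-cong ℓ ℓ′ r p) (_ ∷ eq ∷ []) =
      zero , cong (λ d → choose x (λ e → role r d e × Holds p e)) eq ∷ []
    rule-sound (closure ℓ p) (h ∷ ¬h ∷ [])    = ⊥-elim (¬h h)
    rule-sound (ub′ ℓ ℓ′) _ with em {den ℓ ≡ den ℓ′}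
    ... | yes eq = zero , eq ∷ []
    ... | no ¬eq = suc zero , ¬eq ∷ []

    module _ {S : ConceptSet} (T : Tableau S) (sat : ∀ C → C ∈ S → ⟦ I ⟧ C x) where
      open Tableau T

      TrueNode : Set
      TrueNode = Σ[ h ∈ History ] (Node rule-at h × (∀ {φ} → φ ∈ formulas S h → True φ))

      true-successor : (μ : TrueNode) → Σ[ μ′ ∈ TrueNode ] Step T (proj₁ μ) (proj₁ μ′)
      true-successor (h , ν , tr) with rule-at h in eq
      ... | nothing = (h , ν , tr) , halt (λ _ eq′ → absurd (≡-trans (≡-sym eq) eq′))
        where
        absurd : ∀ {A : Set} {ρ : Rule} → nothing ≡ just ρ → A
        absurd ()
      ... | just ρ =
        let i , all = rule-sound ρ (All.map tr (applicable ν eq))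
        in ((ρ , i) ∷ h , child ν eq i , [ tr , All.lookup all ]′) , extend eq i

      true-path : ℕ → TrueNode
      true-path zero    = [] , root , λ { (C , C∈S , refl) → holds⇐ C (sat C C∈S) }
      true-path (suc n) = proj₁ (true-successor (true-path n))

      true-branch : Branch T
      true-branch = record
        { at    = proj₁ ∘ true-path
        ; start = refl
        ; step  = proj₂ ∘ true-successor ∘ true-path
        }

      true-branch-true : ∀ n {φ} → φ ∈ formulas S (Branch.at true-branch n) → True φ
      true-branch-true n = proj₂ (proj₂ (true-path n))

      -- The premises of a closure rule applied here would be true, and `rule-sound` would return a
      -- conclusion of a rule that has none.
      true-branch-open : OpenBranch T true-branch
      true-branch-open (ρ , none , n , eq) = no-choice {ρ} none (proj₁ (rule-sound ρ
        (All.map (true-branch-true n) (applicable (branch-node T true-branch n) eq))))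

  sound : Sound
  sound S (I , x , sat) T _ closed =
    true-branch-open T sat (closed (true-branch T sat))
    where open Guide I x

  -- The canonical model

  module Canonical {B : Formulas} (hintikka : Hintikka B) where
    open Hintikka hintikka

    open Equality static

    contradictory : ∀ {t C} → (t ∶ C) ∈ B → (t ∶ ¬ᶜ C) ∈ B → ⊥
    contradictory m m′ with () ← proj₁ (static (closure _ _) (λ ()) (m ∷ m′ ∷ []))

    least-in-class : ∀ {t} → IsLabel B t → ∃[ u ] (t ∼ u × (∀ v → t ∼ v → code u ≤ code v))
    least-in-class l = least code _ (_ , ∼-refl l)

    rep : Term → Term
    rep t = choose t (λ u → t ∼ u × (∀ v → t ∼ v → code u ≤ code v))

    rep-∼ : ∀ {t} → IsLabel B t → t ∼ rep t
    rep-∼ l = proj₁ (choose-satisfies _ (least-in-class l))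

    rep-least : ∀ {t} → IsLabel B t → ∀ v → t ∼ v → code (rep t) ≤ code v
    rep-least l = proj₂ (choose-satisfies _ (least-in-class l))

    -- Each representative lies in the class of the other, so both have the least code there, and
    -- codes are injective.
    rep-cong : ∀ {t u} → t ∼ u → rep t ≡ rep u
    rep-cong eq = code-injective (≤-antisym
      (rep-least l _ (∼-trans eq (rep-∼ l′)))
      (rep-least l′ _ (∼-trans (∼-sym eq) (rep-∼ l))))
      where
      l  = _ , eq
      l′ = _ , ∼-sym eq

    IsRep : Term → Set
    IsRep u = ∃[ t ] (IsLabel B t × rep t ≡ u)

    -- A class is given by its member of least code, as there are no quotient types.
    -- Irrelevance of the proof makes classes with equal representatives equal.
    record Class : Set where
      constructor class
      field
        val    : Term
        .isRep : IsRep val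

    open Class

    class-≡ : ∀ {d e} → val d ≡ val e → d ≡ e
    class-≡ refl = refl

    val-rep : ∀ d → IsRep (val d)
    -- Excluded middle decides `IsRep`, which allows the irrelevant proof to be recovered.
    val-rep (class _ isRep) = recompute em isRep

    den : Term → Class
    den t with em {IsLabel B t}
    ... | yes l = class (rep t) (t , l , refl)
    -- A term that is not a label has no class of its own and receives that of some fixed label.
    ... | no _  = class (rep (proj₁ inhabited)) (_ , proj₂ inhabited , refl)

    val-den : ∀ {t} → IsLabel B t → val (den t) ≡ rep t
    val-den {t} l with em {IsLabel B t}
    ... | yes _ = refl
    ... | no ¬l = ⊥-elim (¬l l)

    den-∼ : ∀ {t} → IsLabel B t → t ∼ val (den t)
    den-∼ {t} l = ≡-subst (t ∼_) (≡-sym (val-den l)) (rep-∼ l)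

    den-onto : ∀ d → ∃[ t ] (IsLabel B t × den t ≡ d)
    den-onto d = let t , l , eq = val-rep d in t , l , class-≡ (≡-trans (val-den l) eq)

    den⇒∼ : ∀ {t u} → IsLabel B t → IsLabel B u → den t ≡ den u → t ∼ u
    den⇒∼ {t} l l′ eq = ∼-trans (≡-subst (λ d → t ∼ val d) eq (den-∼ l)) (∼-sym (den-∼ l′))

    ∼⇒den : ∀ {t u} → t ∼ u → den t ≡ den u
    ∼⇒den eq = class-≡ (≡-trans (val-den (_ , eq))
                         (≡-trans (rep-cong eq) (≡-sym (val-den (_ , ∼-sym eq)))))

    -- Symbols are read off at the representatives, which spares any proof of independence;
    -- `∼-subst` and `edge-target` move formulas to and from them.
    model : Model
    model = record
      { Δ          = Class
      ; ind        = den ∘ ind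
      ; conc       = λ p d → (val d ∶ atom p) ∈ B
      ; role       = λ r d e → (val d ∶ ∃ᶜ r (nom (val e))) ∈ B
      ; role-trans = λ r m m′ → transitive m m′
      }
      where
      transitive : ∀ {t u v r} → (t ∶ ∃ᶜ r (nom u)) ∈ B → (u ∶ ∃ᶜ r (nom v)) ∈ B →
                   (t ∶ ∃ᶜ r (nom v)) ∈ B
      transitive m m′ with static (trans _ _ _ _) (λ ()) (m ∷ m′ ∷ [])
      ... | zero , m″ ∷ [] = m″

    termModel : TermModel
    termModel = record { model = model ; den = den ; den-ind = λ _ → refl }

    -- `B` need not contain one of `t ∶ C` and `t ∶ ¬ᶜ C`, so `falsity` does not follow from
    -- `truth`; the two are proved by simultaneous induction on the concept.
    truth : ∀ {t} C → Plain C → (t ∶ C) ∈ B → ⟦ termModel ⟧ˣ C (den t)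
    falsity : ∀ {t} C → Plain C → (t ∶ ¬ᶜ C) ∈ B → ¬ ⟦ termModel ⟧ˣ C (den t)

    truth (atom p) _ m = ∼-subst (den-∼ (_ , m)) m
    truth (nom u) _ m  = ∼⇒den m
    truth (¬ᶜ C) pl m  = falsity C pl m
    truth (C ∨ᶜ D) (pl , pl′) m with static (or _ _ _) (λ ()) (m ∷ [])
    ... | zero , m′ ∷ []     = inj₁ (truth C pl m′)
    ... | suc zero , m′ ∷ [] = inj₂ (truth D pl′ m′)
    truth (∃ᶜ r C) pl m =
      let u , m₁ , m₂ = witness m
      in den u ,
         edge-target (∼-subst (den-∼ (_ , m₁)) m₁) (den-∼ (_ , m₂)) ,
         truth C pl m₂

    falsity (atom p) _ m h = contradictory (∼-subst (∼-sym (den-∼ (_ , m))) h) m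
    -- The rule `not-nom` makes `u` a label, so that `den u` is its class and not the default.
    falsity (nom u) _ m eq with static (not-nom _ _) (λ ()) (m ∷ [])
    ... | zero , m′ ∷ [] = contradictory (den⇒∼ (_ , m) (_ , m′) eq) m
    falsity (¬ᶜ C) pl m h with static (not-not _ _) (λ ()) (m ∷ [])
    ... | zero , m′ ∷ [] = h (truth C pl m′)
    falsity (C ∨ᶜ D) (pl , pl′) m h with static (not-or _ _ _) (λ ()) (m ∷ [])
    ... | zero , m₁ ∷ m₂ ∷ [] = [ falsity C pl m₁ , falsity D pl′ m₂ ]′ h
    falsity {t} (∃ᶜ r C) pl m (d , rel , h)
      with u , l , refl ← den-onto d
      -- The edge between representatives is moved back to `t` and `u`, because both premises of
      -- `not-ex` have the label `t`.
      with static (not-ex _ _ _ _) (λ ())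
             (m ∷ edge-target (∼-subst (∼-sym (den-∼ (_ , m))) rel) (∼-sym (den-∼ l)) ∷ [])
    ... | zero , m′ ∷ [] = falsity C pl m′ h

    canonicalModel : CanonicalModel B
    canonicalModel = record
      { termModel = termModel
      ; onto      = den-onto
      ; kernel    = λ t u l l′ → mk⇔ (den⇒∼ l l′) ∼⇒den
      ; truth     = λ t C m → truth C (plain m) m
      }

  complete : ConstructivelyComplete
  complete S (C , C∈S) T fin β opn = canonicalModel
    where
    sat : ∀ ρ → Applicable (⋃ T β) ρ → Concluded (⋃ T β) ρ
    sat ρ = saturated T β {Exempt = λ _ _ → ⊥} (λ β opn ρ app _ → fin β opn ρ app) opn ρ id
    hintikka : Hintikka (⋃ T β)
    hintikka = record
      { inhabited = fresh , embed C , root-formula T β C∈S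
      ; plain     = branch-plain T β
      ; static    = λ ρ _ → sat ρ
      ; witness   = wit
      }
      where
      wit : ∀ {t r C} → (t ∶ ∃ᶜ r C) ∈ ⋃ T β →
            ∃[ u ] ((t ∶ ∃ᶜ r (nom u)) ∈ ⋃ T β × (u ∶ C) ∈ ⋃ T β)
      wit m with sat (ex _ _ _) (m ∷ [])
      ... | zero , m₁ ∷ m₂ ∷ [] = _ , m₁ , m₂
    open Canonical hintikka using (canonicalModel)

  hintikka⇒satisfiable : ∀ {S B} → Hintikka B → (∀ {C} → C ∈ S → (fresh ∶ embed C) ∈ B) →
                         Satisfiable S
  hintikka⇒satisfiable hintikka root∈B =
    model , den fresh , λ C C∈S → embed⇒ termModel C (truth fresh (embed C) (root∈B C∈S))
    where open CanonicalModel (Canonical.canonicalModel hintikka)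

  -- Branches with blocking

  module _ {S : ConceptSet} (Cs : List Concept) (S⊆Cs : S ⊆ (_∈ˡ Cs)) (T : Tableau S)
           (β : Branch T) (_<_ : Rel Term 0ℓ) (order : IntroductionOrder T β _<_)
           (opn : OpenBranch T β)
           (sat : ∀ ρ → ¬ Blocked _<_ (⋃ T β) ρ → Applicable (⋃ T β) ρ →
                  Concluded (⋃ T β) ρ) where
    open Branch β
    open IntroductionOrder order
    open IsStrictTotalOrder linear using () renaming (trans to <-trans; irrefl to <-irrefl)

    static-saturated : StaticallySaturated (⋃ T β)
    static-saturated ρ ¬producing = sat ρ (¬producing ∘ proj₁)

    open Equality static-saturated

    -- Terms below an occurring term t occur already at the stage where t is introduced,
    -- so the class of t has a <-least element although < need not be well-founded.
    first-in-class : ∀ {t C} → (t ∶ C) ∈ ⋃ T β →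
                     ∃[ u ] (u ∼ t × (∀ v → v ∼ u → ¬ v < u))
    first-in-class {t} {C} m@(n , m-n)
      with minimal <-irrefl <-trans (_∼ t) (t , member-refl m) (stageTerms Cs S⊆Cs (at n))
    ... | u , u∼t , u-least = u , u∼t , least-u
      where
      t-at-n : Occurs (formulas S (at n)) t
      t-at-n = (t ∶ C) , m-n , label here
      least-u : ∀ v → v ∼ u → ¬ v < u
      least-u v v∼u v<u with em {Occurs (formulas S (at n)) v}
      ... | yes v-at-n = u-least v (stageTerms-complete Cs S⊆Cs (at n) v-at-n)
                           (∼-sym (∼-subst u∼t (∼-sym v∼u))) v<u
      ... | no ¬v-at-n = u-least t (stageTerms-complete Cs S⊆Cs (at n) t-at-n) (member-refl m)
        (<-trans (extends n t-at-n ¬v-at-n (let k , v-k = v∼u in _ , (k , v-k) , label here)) v<u)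

    -- The first member `u` of the class of `t` acts for the whole class. It is not blocked as a
    -- label, since nothing equated with it precedes it. If `C` is a nominal whose term `w` causes
    -- the blocking, then `w` is already a witness. Otherwise `ex` is applied at `u`, and the edge
    -- is transferred to `t`.
    blocked-witness : ∀ {t r C} → (t ∶ ∃ᶜ r C) ∈ ⋃ T β →
                      ∃[ u ] ((t ∶ ∃ᶜ r (nom u)) ∈ ⋃ T β × (u ∶ C) ∈ ⋃ T β)
    blocked-witness {t} {r} {C} m with first-in-class m
    ... | u , u∼t , least-u with em {Blocked _<_ (⋃ T β) (ex u r C)}
    ...   | yes (_ , v , _ , v∼u , v<u , here label) = ⊥-elim (least-u v v∼u v<u)
    ...   | yes (_ , v , w , v∼w , v<w , here linked) = w , m , member-refl (∼-sym v∼w)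
    ...   | no ¬blocked with sat (ex u r C) ¬blocked (∼-subst (∼-sym u∼t) m ∷ [])
    ...     | zero , m₁ ∷ m₂ ∷ [] = _ , ∼-subst u∼t m₁ , m₂

    blocked-hintikka : ∃ S → Hintikka (⋃ T β)
    blocked-hintikka (C , C∈S) = record
      { inhabited = fresh , embed C , root-formula T β C∈S
      ; plain     = branch-plain T β
      ; static    = static-saturated
      ; witness   = blocked-witness
      }

  -- Finite models

  module Filtration (Cs : List Concept) (I : Model) where
    open Closure Cs
    open Model I renaming (ind to indᴵ)

    type : Δ → List Bool
    type d = map (λ C → does (em {⟦ I ⟧ C d})) closureList

    typeRep : List Bool → Δ
    -- The default is for lists of truth values that no element realises.
    typeRep v = choose (indᴵ 0) (λ d → type d ≡ v)

    rep : Δ → Δ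
    rep d = typeRep (type d)

    type-rep : ∀ d → type (rep d) ≡ type d
    type-rep d = choose-satisfies (λ e → type e ≡ type d) (d , refl)

    type-≡ : ∀ {C d e} → C ∈ˡ closureList → type d ≡ type e → ⟦ I ⟧ C d → ⟦ I ⟧ C e
    type-≡ {C} {d} {e} m eq h with em {⟦ I ⟧ C d} | em {⟦ I ⟧ C e} | map-≡⇒≗ eq m
    ... | _      | yes h′ | _ = h′
    ... | no ¬h  | no _   | _ = ⊥-elim (¬h h)

    -- The domain is not shrunk to a quotient; instead individuals and edges of `filtrated` lead
    -- only to these finitely many elements.
    Fixed : Δ → Set
    Fixed d = rep d ≡ d

    rep-fixed : ∀ d → Fixed (rep d)
    rep-fixed d = cong typeRep (type-rep d)

    -- The transitive filtration of Lemmon.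
    filtrated : Model
    filtrated = record
      { Δ          = Δ
      ; ind        = rep ∘ indᴵ
      ; conc       = conc
      ; role       = λ r d e → Fixed e × (∀ C → ∃ᶜ r C ∈ˡ closureList →
                       ⟦ I ⟧ C e ⊎ ⟦ I ⟧ (∃ᶜ r C) e → ⟦ I ⟧ (∃ᶜ r C) d)
      ; role-trans = λ { r (_ , back) (fixed , back′) →
                         fixed , λ C m h → back C m (inj₂ (back′ C m h)) }
      }

    filtrated⇒ : ∀ C {d} → C ∈ˡ closureList → Fixed d → ⟦ filtrated ⟧ C d → ⟦ I ⟧ C d
    filtrated⇐ : ∀ C {d} → C ∈ˡ closureList → Fixed d → ⟦ I ⟧ C d → ⟦ filtrated ⟧ C d

    filtrated⇒ (atom p) m fixed h = h
    -- Since `nom n` is in the closure, `indᴵ n` is the only element of its type and thus its own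
    -- representative.
    filtrated⇒ (nom n) m fixed refl = type-≡ m (≡-sym (type-rep (indᴵ n))) refl
    filtrated⇒ (¬ᶜ C) m fixed h = h ∘ filtrated⇐ C (¬-closed m) fixed
    filtrated⇒ (C ∨ᶜ D) m fixed (inj₁ h) = inj₁ (filtrated⇒ C (∨-closedˡ m) fixed h)
    filtrated⇒ (C ∨ᶜ D) m fixed (inj₂ h) = inj₂ (filtrated⇒ D (∨-closedʳ m) fixed h)
    filtrated⇒ (∃ᶜ r C) m fixed (e , (fixed′ , back) , h) =
      back C m (inj₁ (filtrated⇒ C (∃-closed m) fixed′ h))

    filtrated⇐ (atom p) m fixed h = h
    filtrated⇐ (nom n) m fixed refl = ≡-sym fixed
    filtrated⇐ (¬ᶜ C) m fixed h = h ∘ filtrated⇒ C (¬-closed m) fixed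
    filtrated⇐ (C ∨ᶜ D) m fixed (inj₁ h) = inj₁ (filtrated⇐ C (∨-closedˡ m) fixed h)
    filtrated⇐ (C ∨ᶜ D) m fixed (inj₂ h) = inj₂ (filtrated⇐ D (∨-closedʳ m) fixed h)
    filtrated⇐ (∃ᶜ r C) {d} m fixed (e , rel , h) =
      rep e , (rep-fixed e , back) ,
      filtrated⇐ C (∃-closed m) (rep-fixed e) (type-≡ (∃-closed m) (≡-sym (type-rep e)) h)
      where
      back : ∀ D → ∃ᶜ r D ∈ˡ closureList →
             ⟦ I ⟧ D (rep e) ⊎ ⟦ I ⟧ (∃ᶜ r D) (rep e) → ⟦ I ⟧ (∃ᶜ r D) d
      back D m′ (inj₁ h′) = e , rel , type-≡ (∃-closed m′) (type-rep e) h′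
      -- This case uses transitivity in `I`: a successor of `e` is a successor of `d`.
      back D m′ (inj₂ h′) with e′ , rel′ , h″ ← type-≡ m′ (type-rep e) h′ =
        e′ , role-trans r rel rel′ , h″

    points : List Δ
    points = map typeRep (words (length closureList) (true ∷ false ∷ []))

    -- A fixed element is the value of `typeRep` at its own type, one of finitely many lists of
    -- truth values.
    fixed-point : ∀ {d} → Fixed d → d ∈ˡ points
    fixed-point {d} fixed = ≡-subst (_∈ˡ points) fixed (∈-map⁺ typeRep
      (≡-subst (λ n → type d ∈ˡ words n (true ∷ false ∷ []))
        (length-map _ closureList) (words-complete (All.tabulate (λ {b} _ → bool b)))))
      where
      bool : ∀ b → b ∈ˡ true ∷ false ∷ []
      bool true  = here refl
      bool false = there (here refl)

  -- König's lemma

  module _ {S : ConceptSet} (T : Tableau S) where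
    open Tableau T

    data Below (h : History) : History → Set where
      self  : Below h h
      below : ∀ {h′ ρ} → Below h h′ → rule-at h′ ≡ just ρ → (i : Choice ρ) → Below h ((ρ , i) ∷ h′)

    below-root : ∀ {h} → Node rule-at h → Below [] h
    below-root root           = self
    below-root (child ν eq i) = below (below-root ν) eq i

    FiniteBelow : History → Set
    FiniteBelow h = ∃[ hs ] (∀ h′ → Below h h′ → h′ ∈ˡ hs)

    -- `Below` grows at its lower end; the argument on infinite subtrees needs the first step below
    -- `h` instead.
    below-cases : ∀ {h h′} → Below h h′ →
                  h′ ≡ h ⊎ ∃[ ρ ] ∃[ i ] (rule-at h ≡ just ρ × Below ((ρ , i) ∷ h) h′)
    below-cases self = inj₁ refl
    below-cases (below b eq i) with below-cases b
    ... | inj₁ refl             = inj₂ (_ , i , eq , self)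
    ... | inj₂ (ρ , j , e , b′) = inj₂ (ρ , j , e , below b′ eq i)

    -- A rule has finitely many conclusions. If the subtrees of all children were finite, their
    -- lists together with `h` would cover the subtree of `h`.
    infinite-child : ∀ h → ¬ FiniteBelow h →
      ∃[ ρ ] ∃[ i ] (rule-at h ≡ just ρ × ¬ FiniteBelow ((ρ , i) ∷ h))
    infinite-child h infinite
      with em {∃[ ρ ] ∃[ i ] (rule-at h ≡ just ρ × ¬ FiniteBelow ((ρ , i) ∷ h))}
    ... | yes found = found
    ... | no none with rule-at h in eq
    ...   | nothing = ⊥-elim (infinite (h ∷ [] , only))
      where
      only : ∀ h′ → Below h h′ → h′ ∈ˡ h ∷ []
      only h′ b with below-cases b
      ... | inj₁ refl = here refl
      ... | inj₂ (ρ , _ , e , _) with () ← ≡-trans (≡-sym eq) e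
    ...   | just ρ = ⊥-elim (infinite (h ∷ concatMap (proj₁ ∘ finite-child) (tabulate id) , covers))
      where
      finite-child : ∀ i → FiniteBelow ((ρ , i) ∷ h)
      finite-child i = by-contradiction (λ ¬fin → none (ρ , i , refl , ¬fin))
      covers : ∀ h′ → Below h h′ → h′ ∈ˡ h ∷ concatMap (proj₁ ∘ finite-child) (tabulate id)
      covers h′ b with below-cases b
      ... | inj₁ refl = here refl
      ... | inj₂ (ρ′ , i , e , b′) with refl ← just-injective (≡-trans (≡-sym eq) e) =
        there (∈-concatMap⁺ (proj₁ ∘ finite-child)
          (Any.map (λ { refl → proj₂ (finite-child i) h′ b′ }) (∈-tabulate⁺ i)))

    -- The path through infinite subtrees has a successor at every node, so no closure rule is ever
    -- applied on it.
    closed⇒finite : Closed T → FiniteTableau T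
    closed⇒finite closed with em {FiniteBelow []}
    ... | yes (hs , covers) = hs , λ h ν → covers h (below-root ν)
    ... | no infinite = ⊥-elim (no-closure (closed branch))
      where
      path : ℕ → ∃[ h ] ¬ FiniteBelow h
      path zero    = [] , infinite
      path (suc n) = let h , inf = path n ; ρ , i , _ , inf′ = infinite-child h inf
                     in (ρ , i) ∷ h , inf′
      branch : Branch T
      branch = record
        { at = proj₁ ∘ path ; start = refl
        ; step = λ n → let h , inf = path n ; _ , i , eq , _ = infinite-child h inf in extend eq i }
      no-closure : ¬ ClosedBranch T branch
      no-closure (ρ , none , n , eq) =
        let h , inf = path n
            _ , i , eq′ , _ = infinite-child h inf
        in no-choice {ρ} none (≡-subst Choice (just-injective (≡-trans (≡-sym eq′) eq)) i)

  -- Termination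

  module _ {S : ConceptSet} (T : Tableau S) (β : Branch T) where
    open Tableau T
    open Branch β

    step-rule : ∀ {h h′} → ¬ Leaf T h → Step T h h′ → ∃[ ρ ] (rule-at h ≡ just ρ × ρ ∈ˡ applied h′)
    step-rule nonleaf (extend eq i) = _ , eq , here refl
    step-rule nonleaf (halt leaf)   = ⊥-elim (nonleaf leaf)

    module _ (nonleaf : ∀ n → ¬ Leaf T (at n)) where

      nth-rule : ℕ → Rule
      nth-rule n = proj₁ (step-rule (nonleaf n) (step n))

      rule-applicable : ∀ n → Applicable (formulas S (at n)) (nth-rule n)
      rule-applicable n =
        applicable (branch-node T β n) (proj₁ (proj₂ (step-rule (nonleaf n) (step n))))

      rules-distinct : ∀ {m n} → m < n → nth-rule m ≢ nth-rule n
      rules-distinct {m} {n} m<n eq =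
        once (branch-node T β n) (proj₁ (proj₂ (step-rule (nonleaf n) (step n))))
          (≡-subst (_∈ˡ applied (at n)) eq (branch-applied T β (≤⇒≤′ m<n)
            (proj₂ (proj₂ (step-rule (nonleaf m) (step m))))))

      rule-injective : ∀ {m n} → nth-rule m ≡ nth-rule n → m ≡ n
      rule-injective {m} {n} eq with <-cmp m n
      ... | tri< m<n _ _ = ⊥-elim (rules-distinct m<n eq)
      ... | tri≈ _ m≡n _ = m≡n
      ... | tri> _ _ n<m = ⊥-elim (rules-distinct n<m (≡-sym eq))

    -- Without a leaf every stage applies a rule instance, never the same one twice, so the natural
    -- numbers would inject into the finite list of keys.
    finitely-many-formulas⇒finite : (φs : List XConcept) →
      (∀ n {φ} → φ ∈ formulas S (at n) → φ ∈ˡ φs) → FiniteBranch T β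
    finitely-many-formulas⇒finite φs bound = by-contradiction λ infinite →
      let nonleaf = λ n leaf → infinite (n , leaf)
      in finite (mk↣ {to = key ∘ nth-rule nonleaf} (rule-injective nonleaf ∘ key-injective)) (keys φs)
           (λ n → keys-complete (nth-rule nonleaf n) (All.map (bound n) (rule-applicable nonleaf n)))

  module GuidedTermination
    {S : ConceptSet} (Cs : List Concept) (S⊆Cs : S ⊆ (_∈ˡ Cs)) (T : Tableau S)
    (I : Model) (x : Model.Δ I) (sat : ∀ C → C ∈ S → ⟦ I ⟧ C x)
    (points : List (Model.Δ I)) (den∈points : ∀ t → Guide.den I x t ∈ˡ points)
    (_<_ : Rel Term 0ℓ) (order : IntroductionOrder T (Guide.true-branch I x T sat) _<_)
    where

    open Tableau T
    open Guide I x using (den; true-branch-true)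

    β : Branch T
    β = Guide.true-branch I x T sat

    open Branch β
    open IntroductionOrder order
    open IsStrictTotalOrder linear using (compare)
      renaming (trans to <-trans; irrefl to <-irrefl; asym to <-asym)

    Γ : ℕ → Formulas
    Γ n = formulas S (at n)

    -- A new term is created by ex as a label, or by f-cong as an equal of an earlier term.
    tracked : ∀ n {v} → ¬ Occurs (Γ 0) v → Occurs (Γ n) v →
              IsLabel (Γ n) v ⊎ ∃[ t ] ((t ∶ nom v) ∈ Γ n × t < v)
    tracked zero new occ = ⊥-elim (new occ)
    tracked (suc n) {v} new occ with em {Occurs (Γ n) v}
    ... | yes occ-n = Sum.map (map₂ (step-formulas T (step n)))
                        (λ { (t , m , t<v) → t , step-formulas T (step n) m , t<v })
                        (tracked n new occ-n)
    ... | no ¬occ-n with step-occurs T (branch-node T β n) (step n) occ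
    ...   | inj₁ occ-n = ⊥-elim (¬occ-n occ-n)
    ...   | inj₂ (_ , zero , eq , ex , _ ∷ m ∷ []) = inj₁ (_ , m)
    ...   | inj₂ (_ , zero , eq , f-cong , m ∷ []) with applicable (branch-node T β n) eq
    ...     | m′ ∷ _ = inj₂ (_ , m , extends n (_ , m′ , label here) ¬occ-n
                                       (let φ , φ∈ , o = occ in φ , (suc n , φ∈) , o))

    module _
      (c1 : ∀ n ρ → rule-at (at n) ≡ just ρ → ¬ Blocked _<_ (Γ n) ρ)
      (N : ℕ)
      (c2 : ∀ n → N ≤ n → ∀ ρ → rule-at (at n) ≡ just ρ → TermProducing (Γ n) ρ →
            ∀ ℓ ℓ′ → IsLabel (Γ n) ℓ → IsLabel (Γ n) ℓ′ → ub′ ℓ ℓ′ ∈ˡ applied (at n))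
      where

      -- After stage `N` new terms are assembled from active ones only, so a bound on the active
      -- terms bounds all terms.
      record Active (t : Term) : Set where
        field
          {stage}   : ℕ
          {rule}    : Rule
          late      : N ≤ stage
          performed : rule-at (at stage) ≡ just rule
          producing : TermProducing (Γ stage) rule
          involved  : Any (_with-term t) (premises rule)

        occurs : Occurs (Γ stage) t
        occurs with φ , φ∈ , w ← find involved =
          φ , All.lookup (applicable (branch-node T β stage) performed) φ∈ , with-term-occurs w

        occurs-⋃ : Occurs (⋃ T β) t
        occurs-⋃ with φ , φ∈ , o ← occurs = φ , (stage , φ∈) , o

        not-equated : ∀ {s} → (s ∶ nom t) ∈ Γ stage → ¬ s < t
        not-equated m s<t = c1 stage rule performed (producing , _ , t , m , s<t , involved)

        -- By (c2) `ub′ s t` has been applied. Its first conclusion would block the step, contrary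
        -- to (c1), and its second is false in the guiding model.
        least-label : ∀ {s} → IsLabel (Γ stage) t → IsLabel (Γ stage) s → den s ≡ den t →
                      ¬ s < t
        least-label l l′ eq s<t
          with conclusions-of-applied (at stage) (c2 stage late rule performed producing _ _ l′ l)
        ... | zero , m ∷ []     = not-equated m s<t
        ... | suc zero , m ∷ [] = true-branch-true T sat stage m eq

        -- If `s` precedes `t`, it occurs at the stage already. There `t` must be a label, as (c1)
        -- excludes an earlier equal. If `s` is not known to be a label, it is equated with an
        -- earlier label of the same denotation, which takes its place.
        least-new : ∀ {s} → ¬ Occurs (Γ 0) t → ¬ Occurs (Γ 0) s → Occurs (⋃ T β) s →
                    den s ≡ den t → ¬ s < t
        least-new {s} new new′ occ eq s<t with em {Occurs (Γ stage) s}
        ... | no ¬occ = <-asym s<t (extends stage occurs ¬occ occ)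
        ... | yes occ-s with tracked stage new occurs | tracked stage new′ occ-s
        ...   | inj₂ (_ , m , u<t) | _ = not-equated m u<t
        ...   | inj₁ l | inj₁ l′ = least-label l l′ eq s<t
        ...   | inj₁ l | inj₂ (u , m , u<s) = least-label l (_ , m)
                  (≡-trans (true-branch-true T sat stage m) eq) (<-trans u<s s<t)

      open Active

      active-unique : ∀ {t u} → Active t → Active u → ¬ Occurs (Γ 0) t → ¬ Occurs (Γ 0) u →
                      den t ≡ den u → t ≡ u
      active-unique {t} {u} a b new new′ eq with compare t u
      ... | tri≈ _ t≡u _ = t≡u
      ... | tri< t<u _ _ = ⊥-elim (least-new b new′ new (occurs-⋃ a) eq t<u)
      ... | tri> _ _ u<t = ⊥-elim (least-new a new new′ (occurs-⋃ b) (≡-sym eq) u<t)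

      NewActive : Model.Δ I → Term → Set
      NewActive d t = Active t × ¬ Occurs (Γ 0) t × den t ≡ d

      -- Terms of the root need not be labels, so `ub′` may never compare them; they are listed
      -- outright. Each point adds its only new active term, or `fresh` if there is none.
      actives : List Term
      actives = stageTerms Cs S⊆Cs (at 0) ++ map (choose fresh ∘ NewActive) points

      actives-complete : ∀ {t} → Active t → t ∈ˡ actives
      actives-complete {t} a with em {Occurs (Γ 0) t}
      ... | yes occ = ∈-++⁺ˡ (stageTerms-complete Cs S⊆Cs (at 0) occ)
      ... | no new with choose-satisfies {default = fresh} (NewActive (den t)) (t , a , new , refl)
      ...   | b , new′ , eq = ∈-++⁺ʳ (stageTerms Cs S⊆Cs (at 0))
                (≡-subst (_∈ˡ map (choose fresh ∘ NewActive) points) (active-unique b a new′ new eq)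
                  (∈-map⁺ (choose fresh ∘ NewActive) (den∈points t)))

      open Closure Cs using (closureList-⊇; embeddedClosure; embedded-closed)

      formula-shaped : ∀ n {φ} → φ ∈ Γ n → Shaped (_∈ˡ embeddedClosure) φ
      formula-shaped n m = branch-shaped embedded-closed T
        (λ C C∈S → ∈-map⁺ embed (closureList-⊇ (S⊆Cs C∈S))) β (n , m)

      initialTerms expandedTerms congruentTerms allTerms : List Term
      initialTerms   = stageTerms Cs S⊆Cs (at N)
      expandedTerms  = cartesianProductWith produce (shapes embeddedClosure actives) actives
      congruentTerms = cartesianProductWith reargue actives actives
      allTerms       = initialTerms ++ expandedTerms ++ congruentTerms

      -- For `ex` the label is active, and so is `u` when the concept is a link to `u`, which leaves
      -- finitely many shapes. For `f-cong` both `f r p ℓ` and `ℓ′` are active, and they determine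
      -- `f r p ℓ′`.
      produced-∈ : ∀ n → N ≤ n → ∀ {ρ t} → rule-at (at n) ≡ just ρ → Produces ρ t →
                   ¬ Occurs (Γ n) t → t ∈ˡ allTerms
      produced-∈ n N≤n performed ex _ with applicable (branch-node T β n) performed
      ... | m ∷ [] with formula-shaped n m
      ...   | shaped s = ∈-++⁺ʳ initialTerms (∈-++⁺ˡ (∈-cartesianProductWith⁺ produce
                (shapes-complete {us = actives} s λ { link → actives-complete (active linked) })
                (actives-complete (active label))))
        where
        active : ∀ {t} → _ with-term t → Active t
        active w = record { late = N≤n ; performed = performed ; producing = ex ; involved = here w }
      produced-∈ n N≤n performed f-cong new =
        ∈-++⁺ʳ initialTerms (∈-++⁺ʳ expandedTerms (∈-cartesianProductWith⁺ reargue
          (actives-complete (active (here label))) (actives-complete (active (there (here equal))))))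
        where
        active : ∀ {t} → Any (_with-term t) _ → Active t
        active w =
          record { late = N≤n ; performed = performed ; producing = f-cong new ; involved = w }

      allTerms-complete : ∀ n {t} → Occurs (Γ n) t → t ∈ˡ allTerms
      allTerms-complete n {t} (φ , m , o) with n ≤? N
      ... | yes n≤N = ∈-++⁺ˡ (stageTerms-complete Cs S⊆Cs (at N)
                            (φ , branch-formulas T β (≤⇒≤′ n≤N) m , o))
      allTerms-complete zero _ | no n≰N = ⊥-elim (n≰N z≤n)
      allTerms-complete (suc n) {t} occ | no n≰N with em {Occurs (Γ n) t}
      ... | yes occ-n = allTerms-complete n occ-n
      ... | no ¬occ-n with step-occurs T (branch-node T β n) (step n) occ
      ...   | inj₁ occ-n = ⊥-elim (¬occ-n occ-n)
      ...   | inj₂ (_ , _ , performed , prod , _) =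
                -- The stage `suc n` lies beyond `N`, so the step is taken at a stage `n` that is at
                -- least `N`, where (c2) is in force.
                produced-∈ n (≤-pred (≰⇒> n≰N)) performed prod ¬occ-n

      guided-finite : FiniteBranch T β
      guided-finite = finitely-many-formulas⇒finite T β allFormulas bound
        where
        allFormulas : List XConcept
        allFormulas = cartesianProductWith _∶_ allTerms (shapes embeddedClosure allTerms)
        bound : ∀ n {φ} → φ ∈ Γ n → φ ∈ˡ allFormulas
        bound n m with formula-shaped n m
        ... | shaped s = ∈-cartesianProductWith⁺ _∶_
                (allTerms-complete n (_ , m , label here))
                (shapes-complete s λ tgt → allTerms-complete n (_ , m , body (target-occurs tgt)))

  -- Two open branches are involved: an arbitrary one only supplies a model of the input, and the
  -- finite one is guided by the filtration of that model.
  terminating : Terminating C1C2Derivation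
  terminating S (Cs , S⊆Cs) T (< , orders , c1 , c2 , fin) =
    closed⇒finite T , λ T-open → finite-open-branch (satisfiable T-open)
    where
    satisfiable : Open T → Satisfiable S
    satisfiable T-open with em {∃ S}
    ... | no empty = empty-satisfiable empty
    ... | yes nonempty =
      let β , opn = by-contradiction (λ none → T-open (λ β →
                      by-contradiction (λ opn → none (β , opn))))
      in hintikka⇒satisfiable
           (blocked-hintikka Cs S⊆Cs T β (< β) (orders β) opn (saturated T β fin opn) nonempty)
           (root-formula T β)

    finite-open-branch : Satisfiable S → ∃[ β ] (OpenBranch T β × FiniteBranch T β)
    finite-open-branch (I , x , sat) =
      let N , c2-N = c2 β (Guide.true-branch-open filtrated (rep x) T sat′)
      in β , Guide.true-branch-open filtrated (rep x) T sat′ ,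
         GuidedTermination.guided-finite Cs S⊆Cs T filtrated (rep x) sat′ points den∈points
           (< β) (orders β) (c1 β) N c2-N
      where
      open Filtration Cs I
      open Closure Cs
      sat′ : ∀ C → C ∈ S → ⟦ filtrated ⟧ C (rep x)
      sat′ C C∈S = filtrated⇐ C m (rep-fixed x) (type-≡ m (≡-sym (type-rep x)) (sat C C∈S))
        where m = closureList-⊇ (S⊆Cs C∈S)
      β : Branch T
      β = Guide.true-branch filtrated (rep x) T sat′
      den∈points : ∀ t → Guide.den filtrated (rep x) t ∈ˡ points
      den∈points t = fixed-point (Guide.den-closed filtrated (rep x) Fixed (rep-fixed x)
        (λ n → rep-fixed (Model.ind I n)) proj₁ t)

theorem8p4 : ExcludedMiddle 0ℓ → Sound × ConstructivelyComplete × Terminating C1C2Derivation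
theorem8p4 em = sound em , complete em , terminating em
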